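{- Let $n\ge 2$ and let $A$ be a c.e. set. If $Q_n(A)$ holds, then $A$ is $n$-tardy.
   Context: Sets are subsets of $\omega$; $\{W_{e}\}_{e\in\omega}$ is the standard listing of the c.e. sets with standard stagewise enumeration $\{W_{e,s}\}_{s\in\omega}$ (only numbers less than $s$ belong to $W_{e,s}$). $\overline{A}=\omega\setminus A$; $X\subseteq^* Y$ means $X\setminus Y$ is finite. $n$-c.e. sets: for $n\ge 1$, a set $X$ is $n$-c.e. iff there are c.e. sets $X_1,\dots,X_n$ such that $X=(X_1-X_2)\cup\dots\cup(X_{n-2}-X_{n-1})\cup X_n$ if $n$ is odd, and $X=(X_1-X_2)\cup\dots\cup(X_{n-1}-X_n)$ if $n$ is even. Fix an effective listing of all such presentations (sequences $W_{e_1},\dots,W_{e_n}$ of c.e. sets given by indices); $X^n_e$ denotes the $e$-th $n$-c.e. set in this listing, and $X^n_{e,s}$ its stage-$s$ approximation, obtained by replacing each $W_{e_i}$ by $W_{e_i,s}$. $n$-tardy: let $A$ be c.e. with a computable enumeration $\{A_s\}_{s\in\omega}$. $A$ is $n$-tardy iff for every nondecreasing total computable function $p$ there is an $e$ such that $X^n_e=\overline{A}$ and, for all $x$ and all $s$, $x\in X^n_{e,s}$ implies $x\notin A_{p(s)}$. (This does not depend on the choice of enumeration of $A$.) $A\subset_m C$ (equivalently $C\supset_m A$; $A$ is a major subset of $C$): $A\subseteq C$, $C-A$ is infinite, and for all $e$, $\overline{C}\subseteq W_e$ implies $\overline{A}\subseteq^* W_e$. $S\sqsubset C$: there is a c.e.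 set $B$ with $S\cup B=C$ and $S\cap B=\emptyset$. The properties $Q_m$, $m\ge 2$ (all set quantifiers range over c.e. sets). For $k\ge 1$, $Q_{2k}(A)$ is the statement $$(\exists C\supset_m A)(\forall B_1\subseteq C)(\forall B_2\subseteq B_1)\cdots(\forall B_k\subseteq B_{k-1})(\exists D_1\subseteq C)(\exists D_2\subseteq D_1)\cdots(\exists D_k\subseteq D_{k-1})$$ $$(\forall S\sqsubset C)(\exists T_1\supseteq\overline{C})(\exists T_2\subseteq T_1)\cdots(\exists T_k\subseteq T_{k-1})\,[\Phi\implies\Psi],$$ where $\Phi$ is: $B_i\cap(S-A)=D_i\cap(S-A)$ for all $1\le i\le k$; and $\Psi$ is: $(A\cup T_{i+1})\cap(S\cap T_i)=B_i\cap(S\cap T_i)$ for all $1\le i<k$, and $A\cap(S\cap T_k)=B_k\cap(S\cap T_k)$. For $k\ge 1$, $Q_{2k+1}(A)$ is the statement $(\exists Y\subseteq\overline{A})\,Q_{2k}(A\cup Y)$. -}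

module Defs where

open import Data.Fin using (Fin; zero; suc; inject₁; fromℕ)
open import Data.Maybe using (Maybe; just; nothing; _>>=_)
open import Data.Nat using (ℕ; zero; suc; _+_; _*_; _%_; ⌊_/2⌋; _≤_; _<_)
open import Data.Nat.InfinitelyOften using (Inf) renaming (Fin to Finite)
open import Data.Product using (_×_; _,_; proj₁; proj₂; ∃-syntax)
open import Data.Vec using (Vec; []; _∷_; map)
open import Data.Vec.Functional using (Vector)
open import Function using (_∘_)
open import Level using (0ℓ)
open import Relation.Binary.Core using (_Preserves_⟶_)
open import Relation.Binary.PropositionalEquality using (_≡_)
open import Relation.Unary
  using (Pred; _∈_; _∉_; _⊆_; _≐_; ∅; ∁; _∩_; _∪_; _∖_; ⋃; _⊥_)

-- Cantor's bijection ℕ × ℕ → ℕ, enumerating each antidiagonal from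
-- (n , 0) to (0 , n).

triangle : ℕ → ℕ
triangle zero    = 0
triangle (suc n) = suc n + triangle n

⟨_,_⟩ : ℕ → ℕ → ℕ
⟨ x , y ⟩ = triangle (x + y) + y

next : ℕ × ℕ → ℕ × ℕ
next (zero  , y) = suc y , zero
next (suc x , y) = x , suc y

unpair : ℕ → ℕ × ℕ
unpair zero    = 0 , 0
unpair (suc n) = next (unpair n)

π₁ π₂ : ℕ → ℕ
π₁ = proj₁ ∘ unpair
π₂ = proj₂ ∘ unpair

-- The unary partial recursive functions, with several arguments passed
-- through ⟨_,_⟩: they are generated from zero, successor and the two
-- projections by pairing, composition, primitive recursion and
-- minimisation.  The arguments of the last four are indices, and
-- `schema e` is the way in which the e-th function is generated.  These
-- arguments are smaller than e, so every index stands for a well-founded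
-- derivation; conversely every derivation has an index, since ⟨_,_⟩ is a
-- bijection.

data Schema : Set where
  zeroˢ sucˢ fstˢ sndˢ : Schema
  pairˢ compˢ recˢ     : (f g : ℕ) → Schema
  minˢ                 : (f : ℕ) → Schema

decode : (tag m : ℕ) → Schema
decode 0 m = zeroˢ
decode 1 m = sucˢ
decode 2 m = fstˢ
decode 3 m = sndˢ
decode 4 m = pairˢ (π₁ m) (π₂ m)
decode 5 m = compˢ (π₁ m) (π₂ m)
decode 6 m = recˢ (π₁ m) (π₂ m)
decode _ m = minˢ m

schema : ℕ → Schema
schema e = decode (π₁ e) (π₂ e)

-- One unfolding of the e-th function, generated by the given schema, when
-- φ i y evaluates the i-th function at y.  With `recˢ f g`,
--   ⟨ a , 0 ⟩ ↦ f a,   ⟨ a , m + 1 ⟩ ↦ g ⟨ a , ⟨ m , value at ⟨ a , m ⟩ ⟩ ⟩,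
-- and `minˢ f` sends ⟨ a , m ⟩ to the least k ≥ m with f ⟨ a , k ⟩ = 0, all
-- of f ⟨ a , m ⟩, …, f ⟨ a , k ⟩ being defined.

recurse : (φ : ℕ → ℕ → Maybe ℕ) (e f g a m : ℕ) → Maybe ℕ
recurse φ e f g a zero    = φ f a
recurse φ e f g a (suc m) = φ e ⟨ a , m ⟩ >>= λ y → φ g ⟨ a , ⟨ m , y ⟩ ⟩

search : (φ : ℕ → ℕ → Maybe ℕ) (e a k v : ℕ) → Maybe ℕ
search φ e a k zero    = just k
search φ e a k (suc _) = φ e ⟨ a , suc k ⟩

unfold : (φ : ℕ → ℕ → Maybe ℕ) (e : ℕ) → Schema → ℕ → Maybe ℕ
unfold φ e zeroˢ       x = just 0
unfold φ e sucˢ        x = just (suc x)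
unfold φ e fstˢ        x = just (π₁ x)
unfold φ e sndˢ        x = just (π₂ x)
unfold φ e (pairˢ f g) x = φ f x >>= λ y → φ g x >>= λ z → just ⟨ y , z ⟩
unfold φ e (compˢ f g) x = φ g x >>= φ f
unfold φ e (recˢ f g)  x = recurse φ e f g (π₁ x) (π₂ x)
unfold φ e (minˢ f)    x = φ f x >>= search φ e (π₁ x) (π₂ x)

-- run s e x is the value of the e-th function at x, provided that its
-- evaluation has at most s nested unfoldings.

run : (s e x : ℕ) → Maybe ℕ
run zero    e x = nothing
run (suc s) e x = unfold (run s) e (schema e) x

Computable : (ℕ → ℕ) → Set
Computable f = ∃[ e ] (∀ x → ∃[ s ] run s e x ≡ just (f x))

W[_,_] : (e s : ℕ) → Pred ℕ 0ℓ
W[ e , s ] x = x < s × ∃[ y ] run s e x ≡ just y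

W : ℕ → Pred ℕ 0ℓ
W e = ⋃ ℕ W[ e ,_]

CE : Pred ℕ 0ℓ → Set
CE A = ∃[ e ] A ≐ W e

-- The finite set with canonical index y: x belongs to it iff the binary
-- digit of y of weight 2 ^ x is 1.

Canonical : ℕ → Pred ℕ 0ℓ
Canonical y zero    = y % 2 ≡ 1
Canonical y (suc x) = Canonical ⌊ y /2⌋ x

record Enumeration (A : Pred ℕ 0ℓ) : Set where
  field
    index      : ℕ → ℕ
    computable : Computable index

  stage : ℕ → Pred ℕ 0ℓ
  stage s = Canonical (index s)

  field
    increasing : ∀ s → stage s ⊆ stage (suc s)
    exhaustive : A ≐ ⋃ ℕ stage

-- (X₁ − X₂) ∪ (X₃ − X₄) ∪ …, ending with the set Xₙ itself when n is odd.

differences : ∀ {n} → Vec (Pred ℕ 0ℓ) n → Pred ℕ 0ℓ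
differences []           = ∅
differences (X ∷ [])     = X
differences (X ∷ Y ∷ Xs) = (X ∖ Y) ∪ differences Xs

-- For n ≥ 1 this is a bijection from ℕ to the n-tuples of indices.

tuple : (n e : ℕ) → Vec ℕ n
tuple zero          e = []
tuple (suc zero)    e = e ∷ []
tuple (suc (suc n)) e = π₁ e ∷ tuple (suc n) (π₂ e)

X^ : (n e : ℕ) → Pred ℕ 0ℓ
X^ n e = differences (map W (tuple n e))

X^[_] : (n e s : ℕ) → Pred ℕ 0ℓ
X^[ n ] e s = differences (map W[_, s ] (tuple n e))

Tardy : (n : ℕ) {A : Pred ℕ 0ℓ} → Enumeration A → Set
Tardy n {A} 𝓐 =
  ∀ (p : ℕ → ℕ) → p Preserves _≤_ ⟶ _≤_ → Computable p →
  ∃[ e ] (X^ n e ≐ ∁ A ×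
          (∀ x s → x ∈ X^[ n ] e s → x ∉ Enumeration.stage 𝓐 (p s)))

infix 4 _⊆*_ _⊂ₘ_ _⊏_

_⊆*_ : Pred ℕ 0ℓ → Pred ℕ 0ℓ → Set
X ⊆* Y = Finite (X ∖ Y)

_⊂ₘ_ : Pred ℕ 0ℓ → Pred ℕ 0ℓ → Set
A ⊂ₘ C = A ⊆ C × Inf (C ∖ A) × (∀ e → ∁ C ⊆ W e → ∁ A ⊆* W e)

_⊏_ : Pred ℕ 0ℓ → Pred ℕ 0ℓ → Set
S ⊏ C = ∃[ b ] (S ∪ W b ≐ C × S ⊥ W b)

-- Below, quantifiers over c.e. sets are quantifiers over indices.  The
-- tuple B₁, …, Bₖ with k = j + 1 is W ∘ b for b : Vector ℕ (suc j), so that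
-- Bᵢ₊₁ is W (b i); `inject₁ i` and `suc i` are consecutive positions, and
-- `fromℕ j` is the last one.

Descending : ∀ {j} → Vector ℕ (suc j) → Set
Descending {j} b = ∀ (i : Fin j) → W (b (suc i)) ⊆ W (b (inject₁ i))

Φ : Pred ℕ 0ℓ → ∀ {j} (b d : Vector ℕ (suc j)) → Pred ℕ 0ℓ → Set
Φ A {j} b d S =
  ∀ (i : Fin (suc j)) → W (b i) ∩ (S ∖ A) ≐ W (d i) ∩ (S ∖ A)

Ψ : Pred ℕ 0ℓ → ∀ {j} (b : Vector ℕ (suc j)) → Pred ℕ 0ℓ →
    (t : Vector ℕ (suc j)) → Set
Ψ A {j} b S t =
  (∀ (i : Fin j) →
     (A ∪ W (t (suc i))) ∩ (S ∩ W (t (inject₁ i)))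
       ≐ W (b (inject₁ i)) ∩ (S ∩ W (t (inject₁ i)))) ×
  A ∩ (S ∩ W (t (fromℕ j))) ≐ W (b (fromℕ j)) ∩ (S ∩ W (t (fromℕ j)))

-- QEven j is the property Q₂ₖ with k = j + 1.

QEven : ℕ → Pred ℕ 0ℓ → Set
QEven j A =
  ∃[ c ] (A ⊂ₘ W c ×
  (∀ (b : Vector ℕ (suc j)) → W (b zero) ⊆ W c → Descending b →
   ∃[ d ] (W (d zero) ⊆ W c × Descending {j} d ×
   (∀ s → W s ⊏ W c →
    ∃[ t ] (∁ (W c) ⊆ W (t zero) × Descending {j} t ×
    (Φ A b d (W s) → Ψ A b (W s) t))))))

data Q : ℕ → Pred ℕ 0ℓ → Set₁ where
  even : ∀ {j A} → QEven j A → Q (2 * suc j) A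
  odd  : ∀ {j A} → ∃[ y ] (W y ⊆ ∁ A × QEven j (A ∪ W y)) →
         Q (suc (2 * suc j)) A

{-# OPTIONS --safe #-}
module Submission where

-- Fix a recursive approximation of A that runs ahead of p, and read Qₙ as a
-- claim about the presentation ∁ A = (T₁ ∖ D₁) ∪ … ∪ (Tₖ ∖ Dₖ).  Each number
-- n is a guess at the indices of all Dᵢ and Tᵢ.  It is good at x if x was
-- never in A and in some Tᵢ ∖ Dᵢ at the same stage, and x is now in A or in
-- some Tᵢ ∖ Dᵢ.  An x not yet in C is promised to n once n is good at all
-- z ≤ x, except for those z in C which are allotted to another guess.  When x
-- enters C it is allotted to the least n to which it has been promised, and
-- Bᵢ takes those x which have entered D₁, …, Dᵢ (as guessed by n) at a stage
-- where they are not in A.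
--
-- With S the set of the elements allotted to guesses with the true D's, Φ
-- holds by construction, so Ψ yields T's such that arbitrarily large x can be
-- promised to some guess n; take the least such n.  Smaller guesses are
-- promised finitely many x only, whereas, A being a major subset of C, almost
-- all of ∁ A is promised to n.  Hence the sets guessed by n present ∁ A up to
-- finitely many elements, and never too late.
--
-- A promise is kept even if n stops being good below x.  So while some z in
-- all Dᵢ is not in A, only elements that were not promised to n can go to
-- weaker guesses, and n loses nothing if z enters A after all.

open import Defs
open import Axiom.ExcludedMiddle using (ExcludedMiddle)
open import Data.Empty using (⊥; ⊥-elim)
open import Data.Fin using (Fin; zero; suc; toℕ; fromℕ; fromℕ<; inject₁)
open import Data.Fin.Properties using (toℕ-inject₁; toℕ-fromℕ; toℕ-fromℕ<; toℕ<n)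
open import Data.Maybe using (Maybe; just)
open import Data.Nat
open import Data.Nat.Induction using (<-rec)
open import Data.Nat.Properties
open import Data.Product using (_×_; _,_; proj₁; proj₂; ∃-syntax; Σ-syntax; map₂)
open import Data.Sum using (_⊎_; inj₁; inj₂; [_,_]′; map₁) renaming (map to map-⊎)
open import Data.Vec using (Vec; []; _∷_; map)
open import Data.Vec.Functional using (Vector)
open import Function using (_∘_)
open import Function.Bundles using (_⇔_; mk⇔; Equivalence)
open import Level using (0ℓ)
open import Relation.Binary.Core using (_Preserves_⟶_)
open import Relation.Binary.Definitions using (tri<; tri≈; tri>)
open import Relation.Binary.PropositionalEquality
open import Relation.Nullary using (¬_; Dec; yes; no)
open import Relation.Nullary.Decidable using (map′; decidable-stable)
open import Relation.Unary using (Pred; _∈_; _∉_; _⊆_; _≐_; ∁; _∩_; _∪_; _∖_; ⋃)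

open Enumeration using (index; computable; stage; increasing; exhaustive)
open Equivalence using (to; from)

-- Pairing

unpair-⟨,⟩ : ∀ x y → unpair ⟨ x , y ⟩ ≡ (x , y)
unpair-⟨,⟩ x y = go (x + y) y x refl
  where
  go : ∀ n y x → x + y ≡ n → unpair (triangle n + y) ≡ (x , y)
  go zero zero x eq rewrite m+n≡0⇒m≡0 x eq = refl
  go (suc n) zero x eq
    rewrite trans (sym (+-identityʳ x)) eq | +-identityʳ (n + triangle n) | +-comm n (triangle n)
          | go n n zero refl = refl
  go n (suc y) x eq rewrite +-suc (triangle n) y | go n y (suc x) (trans (sym (+-suc x y)) eq) = refl

⟨π₁,π₂⟩ : ∀ z → ⟨ π₁ z , π₂ z ⟩ ≡ z
⟨π₁,π₂⟩ zero    = refl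
⟨π₁,π₂⟩ (suc z) = trans (pair-next (unpair z)) (cong suc (⟨π₁,π₂⟩ z))
  where
  pair-next : ∀ p → ⟨ proj₁ (next p) , proj₂ (next p) ⟩ ≡ suc ⟨ proj₁ p , proj₂ p ⟩
  pair-next (zero , y) rewrite +-identityʳ y | +-identityʳ (y + triangle y) = cong suc (+-comm y (triangle y))
  pair-next (suc x , y) rewrite +-suc x y = +-suc _ y

π₁-⟨,⟩ : ∀ x y → π₁ ⟨ x , y ⟩ ≡ x
π₁-⟨,⟩ x y = cong proj₁ (unpair-⟨,⟩ x y)

π₂-⟨,⟩ : ∀ x y → π₂ ⟨ x , y ⟩ ≡ y
π₂-⟨,⟩ x y = cong proj₂ (unpair-⟨,⟩ x y)

n≤triangle : ∀ n → n ≤ triangle n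
n≤triangle zero    = z≤n
n≤triangle (suc n) = m≤m+n (suc n) (triangle n)

triangle-mono : ∀ {m n} → m ≤ n → triangle m ≤ triangle n
triangle-mono z≤n         = z≤n
triangle-mono (s≤s m≤n) = +-mono-≤ (s≤s m≤n) (triangle-mono m≤n)

x≤⟨x,y⟩ : ∀ x y → x ≤ ⟨ x , y ⟩
x≤⟨x,y⟩ x y = ≤-trans (m≤m+n x y) (≤-trans (n≤triangle (x + y)) (m≤m+n _ y))

y≤⟨x,y⟩ : ∀ x y → y ≤ ⟨ x , y ⟩
y≤⟨x,y⟩ x y = m≤n+m y _

π₁-≤ : ∀ z → π₁ z ≤ z
π₁-≤ z = subst (π₁ z ≤_) (⟨π₁,π₂⟩ z) (x≤⟨x,y⟩ _ (π₂ z))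

⟨,⟩-mono-≤ : ∀ {x x′ y y′} → x ≤ x′ → y ≤ y′ → ⟨ x , y ⟩ ≤ ⟨ x′ , y′ ⟩
⟨,⟩-mono-≤ p q = +-mono-≤ (triangle-mono (+-mono-≤ p q)) q

⟨,⟩-mono-≤-< : ∀ {x x′ y y′} → x ≤ x′ → y < y′ → ⟨ x , y ⟩ < ⟨ x′ , y′ ⟩
⟨,⟩-mono-≤-< p q = +-mono-≤-< (triangle-mono (+-mono-≤ p (<⇒≤ q))) q

-- Evaluation as a relation

private
  Graph : Set₁
  Graph = ℕ → ℕ → ℕ → Set

Recurses : Graph → (e f g a m y : ℕ) → Set
Recurses O e f g a zero    y = O f a y
Recurses O e f g a (suc m) y = ∃[ z ] (O e ⟨ a , m ⟩ z × O g ⟨ a , ⟨ m , z ⟩ ⟩ y)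

Searches : Graph → (e a k y v : ℕ) → Set
Searches O e a k y zero    = y ≡ k
Searches O e a k y (suc _) = O e ⟨ a , suc k ⟩ y

-- `O` occurs only positively, so the same clauses serve for evaluation with bounded nesting, for
-- evaluation as such, and for facts derived by stages.
Unfolds : Graph → ℕ → ℕ → ℕ → Schema → Set
Unfolds O e x y zeroˢ       = y ≡ 0
Unfolds O e x y sucˢ        = y ≡ suc x
Unfolds O e x y fstˢ        = y ≡ π₁ x
Unfolds O e x y sndˢ        = y ≡ π₂ x
Unfolds O e x y (pairˢ f g) = O f x (π₁ y) × O g x (π₂ y)
Unfolds O e x y (compˢ f g) = ∃[ z ] (O g x z × O f z y)
Unfolds O e x y (recˢ f g)  = Recurses O e f g (π₁ x) (π₂ x) y
Unfolds O e x y (minˢ f)    = ∃[ v ] (O f x v × Searches O e (π₁ x) (π₂ x) y v)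

Unfolds-map : ∀ {O O′ : Graph} → (∀ {f x y} → O f x y → O′ f x y) →
              ∀ {e x y} σ → Unfolds O e x y σ → Unfolds O′ e x y σ
Unfolds-map h zeroˢ p = p
Unfolds-map h sucˢ p = p
Unfolds-map h fstˢ p = p
Unfolds-map h sndˢ p = p
Unfolds-map h (pairˢ f g) (p , q) = h p , h q
Unfolds-map h (compˢ f g) (z , p , q) = z , h p , h q
Unfolds-map h {x = x} (recˢ f g) p with π₂ x
... | zero = h p
Unfolds-map h (recˢ f g) (z , p , q) | suc m = z , h p , h q
Unfolds-map h (minˢ f) (zero , p , q) = zero , h p , q
Unfolds-map h (minˢ f) (suc v , p , q) = suc v , h p , h q

-- Only two values of O are used, so a bound for both of them suffices.
Unfolds-bound : ∀ {O : ℕ → Graph} → (∀ {s t f x y} → s ≤ t → O s f x y → O t f x y) →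
                ∀ {e x y} σ → Unfolds (λ f x y → ∃[ s ] O s f x y) e x y σ →
                ∃[ s ] Unfolds (O s) e x y σ
Unfolds-bound mono zeroˢ p = 0 , p
Unfolds-bound mono sucˢ p = 0 , p
Unfolds-bound mono fstˢ p = 0 , p
Unfolds-bound mono sndˢ p = 0 , p
Unfolds-bound mono (pairˢ f g) ((s , p) , (t , q)) =
  s ⊔ t , mono (m≤m⊔n s t) p , mono (m≤n⊔m s t) q
Unfolds-bound mono (compˢ f g) (z , (s , p) , (t , q)) =
  s ⊔ t , z , mono (m≤m⊔n s t) p , mono (m≤n⊔m s t) q
Unfolds-bound mono {x = x} (recˢ f g) p with π₂ x
... | zero = p
Unfolds-bound mono (recˢ f g) (z , (s , p) , (t , q)) | suc m =
  s ⊔ t , z , mono (m≤m⊔n s t) p , mono (m≤n⊔m s t) q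
Unfolds-bound mono (minˢ f) (zero , (s , p) , q) = s , zero , p , q
Unfolds-bound mono (minˢ f) (suc v , (s , p) , (t , q)) =
  s ⊔ t , suc v , mono (m≤m⊔n s t) p , mono (m≤n⊔m s t) q

module _ {φ : ℕ → ℕ → Maybe ℕ} where

  private
    O : Graph
    O f x y = φ f x ≡ just y

  unfold⇒Unfolds : ∀ {e x y} σ → unfold φ e σ x ≡ just y → Unfolds O e x y σ
  unfold⇒Unfolds zeroˢ refl = refl
  unfold⇒Unfolds sucˢ refl = refl
  unfold⇒Unfolds fstˢ refl = refl
  unfold⇒Unfolds sndˢ refl = refl
  unfold⇒Unfolds {x = x} (pairˢ f g) eq with φ f x | φ g x
  unfold⇒Unfolds (pairˢ f g) refl | just u | just v =
    cong just (sym (π₁-⟨,⟩ u v)) , cong just (sym (π₂-⟨,⟩ u v))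
  unfold⇒Unfolds {x = x} (compˢ f g) eq with φ g x
  ... | just z = z , refl , eq
  unfold⇒Unfolds {e} {x} (recˢ f g) eq with π₂ x
  ... | zero = eq
  ... | suc m with φ e ⟨ π₁ x , m ⟩
  ...   | just z = z , refl , eq
  unfold⇒Unfolds {x = x} (minˢ f) eq with φ f x
  unfold⇒Unfolds (minˢ f) refl | just zero = zero , refl , refl
  unfold⇒Unfolds (minˢ f) eq   | just (suc v) = suc v , refl , eq

  Unfolds⇒unfold : ∀ {e x y} σ → Unfolds O e x y σ → unfold φ e σ x ≡ just y
  Unfolds⇒unfold zeroˢ refl = refl
  Unfolds⇒unfold sucˢ refl = refl
  Unfolds⇒unfold fstˢ refl = refl
  Unfolds⇒unfold sndˢ refl = refl
  Unfolds⇒unfold {y = y} (pairˢ f g) (p , q) rewrite p | q = cong just (⟨π₁,π₂⟩ y)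
  Unfolds⇒unfold (compˢ f g) (z , p , q) rewrite p = q
  Unfolds⇒unfold {x = x} (recˢ f g) p with π₂ x
  ... | zero = p
  Unfolds⇒unfold (recˢ f g) (z , p , q) | suc m rewrite p = q
  Unfolds⇒unfold (minˢ f) (zero , p , q) rewrite p = cong just (sym q)
  Unfolds⇒unfold (minˢ f) (suc v , p , q) rewrite p = q

Run : ℕ → Graph
Run s e x y = run s e x ≡ just y

Eval : Graph
Eval e x y = ∃[ s ] Run s e x y

Run-suc : ∀ s {e x y} → Run s e x y → Run (suc s) e x y
Run-suc (suc s) {e} p = Unfolds⇒unfold (schema e)
  (Unfolds-map (Run-suc s) (schema e) (unfold⇒Unfolds (schema e) p))

Run-mono : ∀ {s t e x y} → s ≤ t → Run s e x y → Run t e x y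
Run-mono {s} {e = e} {x} {y} s≤t p = go (≤⇒≤′ s≤t)
  where
  go : ∀ {t} → s ≤′ t → Run t e x y
  go ≤′-refl             = p
  go (≤′-step {n = t} q) = Run-suc t {e} (go q)

Eval-unique : ∀ {e x y z} → Eval e x y → Eval e x z → y ≡ z
Eval-unique (s , p) (t , q)
  with refl ← trans (sym (Run-mono (m≤m⊔n s t) p)) (Run-mono (m≤n⊔m s t) q) = refl

eval : ∀ {e σ x y} → schema e ≡ σ → Unfolds Eval e x y σ → Eval e x y
eval {e} refl p with s , q ← Unfolds-bound Run-mono (schema e) p = suc s , Unfolds⇒unfold (schema e) q

uneval : ∀ {e σ x y} → schema e ≡ σ → Eval e x y → Unfolds Eval e x y σ
uneval {e} refl (suc s , p) = Unfolds-map (s ,_) (schema e) (unfold⇒Unfolds (schema e) p)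

Run⇒Unfolds : ∀ s e x {σ y} → schema e ≡ σ → Run (suc s) e x y → Unfolds (Run s) e x y σ
Run⇒Unfolds s e x refl p = unfold⇒Unfolds (schema e) p

schema-⟨,⟩ : ∀ t m → schema ⟨ t , m ⟩ ≡ decode t m
schema-⟨,⟩ t m = cong₂ decode (π₁-⟨,⟩ t m) (π₂-⟨,⟩ t m)

opaque
  zeroᵉ sucᵉ fstᵉ sndᵉ : ℕ
  zeroᵉ = ⟨ 0 , 0 ⟩
  sucᵉ  = ⟨ 1 , 0 ⟩
  fstᵉ  = ⟨ 2 , 0 ⟩
  sndᵉ  = ⟨ 3 , 0 ⟩

  pairᵉ compᵉ recᵉ : ℕ → ℕ → ℕ
  pairᵉ f g = ⟨ 4 , ⟨ f , g ⟩ ⟩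
  compᵉ f g = ⟨ 5 , ⟨ f , g ⟩ ⟩
  recᵉ  f g = ⟨ 6 , ⟨ f , g ⟩ ⟩

  minᵉ : ℕ → ℕ
  minᵉ f = ⟨ 7 , f ⟩

  schema-zeroᵉ : schema zeroᵉ ≡ zeroˢ
  schema-zeroᵉ = schema-⟨,⟩ 0 0

  schema-sucᵉ : schema sucᵉ ≡ sucˢ
  schema-sucᵉ = schema-⟨,⟩ 1 0

  schema-fstᵉ : schema fstᵉ ≡ fstˢ
  schema-fstᵉ = schema-⟨,⟩ 2 0

  schema-sndᵉ : schema sndᵉ ≡ sndˢ
  schema-sndᵉ = schema-⟨,⟩ 3 0

  schema-pairᵉ : ∀ f g → schema (pairᵉ f g) ≡ pairˢ f g
  schema-pairᵉ f g = trans (schema-⟨,⟩ 4 ⟨ f , g ⟩) (cong₂ pairˢ (π₁-⟨,⟩ f g) (π₂-⟨,⟩ f g))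

  schema-compᵉ : ∀ f g → schema (compᵉ f g) ≡ compˢ f g
  schema-compᵉ f g = trans (schema-⟨,⟩ 5 ⟨ f , g ⟩) (cong₂ compˢ (π₁-⟨,⟩ f g) (π₂-⟨,⟩ f g))

  schema-recᵉ : ∀ f g → schema (recᵉ f g) ≡ recˢ f g
  schema-recᵉ f g = trans (schema-⟨,⟩ 6 ⟨ f , g ⟩) (cong₂ recˢ (π₁-⟨,⟩ f g) (π₂-⟨,⟩ f g))

  schema-minᵉ : ∀ f → schema (minᵉ f) ≡ minˢ f
  schema-minᵉ f = schema-⟨,⟩ 7 f

-- Computable functions

private
  variable
    f g h : ℕ → ℕ

zeroᶜ : Computable (λ _ → 0)
zeroᶜ = zeroᵉ , λ x → eval schema-zeroᵉ refl

compᶜ : Computable f → Computable g → Computable (f ∘ g)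
compᶜ (e , p) (e′ , q) = compᵉ e e′ , λ x → eval (schema-compᵉ e e′) (_ , q x , p _)

sucᶜ : Computable f → Computable (suc ∘ f)
sucᶜ = compᶜ (sucᵉ , λ x → eval schema-sucᵉ refl)

fstᶜ : Computable f → Computable (π₁ ∘ f)
fstᶜ = compᶜ (fstᵉ , λ x → eval schema-fstᵉ refl)

sndᶜ : Computable f → Computable (π₂ ∘ f)
sndᶜ = compᶜ (sndᵉ , λ x → eval schema-sndᵉ refl)

pairᶜ : Computable f → Computable g → Computable (λ x → ⟨ f x , g x ⟩)
pairᶜ {f} {g} (e , p) (e′ , q) = pairᵉ e e′ , λ x → eval (schema-pairᵉ e e′)
  (subst (Eval e x) (sym (π₁-⟨,⟩ (f x) (g x))) (p x) , subst (Eval e′ x) (sym (π₂-⟨,⟩ (f x) (g x))) (q x))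

Computable-resp : (∀ x → f x ≡ g x) → Computable f → Computable g
Computable-resp eq (e , p) = e , λ x → subst (Eval e x) (eq x) (p x)

-- No schema is the identity, but pairing the two projections yields it.
idᶜ : Computable (λ x → x)
idᶜ = Computable-resp ⟨π₁,π₂⟩
  (pairᶜ (fstᵉ , λ x → eval schema-fstᵉ refl) (sndᵉ , λ x → eval schema-sndᵉ refl))

constᶜ : ∀ n → Computable (λ _ → n)
constᶜ zero    = zeroᶜ
constᶜ (suc n) = sucᶜ (constᶜ n)

Computable₂ : (ℕ → ℕ → ℕ) → Set
Computable₂ h = Computable (λ z → h (π₁ z) (π₂ z))

Computable₃ : (ℕ → ℕ → ℕ → ℕ) → Set
Computable₃ h = Computable (λ z → h (π₁ z) (π₁ (π₂ z)) (π₂ (π₂ z)))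

app₂ : ∀ h → Computable₂ h → Computable f → Computable g → Computable (λ x → h (f x) (g x))
app₂ {f} {g} h c p q = Computable-resp
  (λ x → cong₂ h (π₁-⟨,⟩ (f x) (g x)) (π₂-⟨,⟩ (f x) (g x))) (compᶜ c (pairᶜ p q))

primrecᶜ : ∀ h G → Computable f → Computable₃ G →
           (∀ a → h a 0 ≡ f a) → (∀ a m → h a (suc m) ≡ G a m (h a m)) → Computable₂ h
primrecᶜ {f} h G (e , p) (e′ , q) eq₀ eq₁ = r , λ z → go (π₂ z) z refl
  where
  r = recᵉ e e′
  go : ∀ m z → π₂ z ≡ m → Eval r z (h (π₁ z) (π₂ z))
  go zero z eq = eval (schema-recᵉ e e′)
    (subst (λ m → Recurses Eval r e e′ (π₁ z) m (h (π₁ z) m)) (sym eq)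
      (subst (Eval e (π₁ z)) (sym (eq₀ (π₁ z))) (p (π₁ z))))
  go (suc m) z eq = eval (schema-recᵉ e e′)
    (subst (λ m → Recurses Eval r e e′ (π₁ z) m (h (π₁ z) m)) (sym eq)
      (h a m , previous , subst (Eval e′ _) value (q _)))
    where
    a = π₁ z
    previous : Eval r ⟨ a , m ⟩ (h a m)
    previous = subst₂ (λ b n → Eval r ⟨ a , m ⟩ (h b n)) (π₁-⟨,⟩ a m) (π₂-⟨,⟩ a m)
      (go m ⟨ a , m ⟩ (π₂-⟨,⟩ a m))
    w = ⟨ a , ⟨ m , h a m ⟩ ⟩
    value : G (π₁ w) (π₁ (π₂ w)) (π₂ (π₂ w)) ≡ h a (suc m)
    value rewrite unpair-⟨,⟩ a ⟨ m , h a m ⟩ | unpair-⟨,⟩ m (h a m) = sym (eq₁ a m)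

iterᶜ : ∀ h G → Computable₂ G → (∀ m → h (suc m) ≡ G m (h m)) → Computable h
iterᶜ h G c eq = Computable-resp (λ m → cong h (π₂-⟨,⟩ 0 m))
  (compᶜ (primrecᶜ (λ _ → h) (λ _ → G) (constᶜ (h 0)) (compᶜ c (sndᶜ idᶜ)) (λ _ → refl) (λ _ → eq))
         (pairᶜ zeroᶜ idᶜ))

opaque
  unfolding pairᵉ compᵉ

  pairᵉᶜ : Computable f → Computable g → Computable (λ x → pairᵉ (f x) (g x))
  pairᵉᶜ c d = pairᶜ (constᶜ 4) (pairᶜ c d)

  compᵉᶜ : Computable f → Computable g → Computable (λ x → compᵉ (f x) (g x))
  compᵉᶜ c d = pairᶜ (constᶜ 5) (pairᶜ c d)

private
  arg₁ : Computable (λ z → π₁ z)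
  arg₁ = fstᶜ idᶜ
  arg₃ : Computable (λ z → π₂ (π₂ z))
  arg₃ = sndᶜ (sndᶜ idᶜ)

+ᶜ : Computable₂ _+_
+ᶜ = primrecᶜ _+_ (λ _ _ → suc) idᶜ (sucᶜ arg₃) +-identityʳ +-suc

predᶜ : Computable pred
predᶜ = iterᶜ pred (λ m _ → m) arg₁ (λ _ → refl)

∸ᶜ : Computable₂ _∸_
∸ᶜ = primrecᶜ _∸_ (λ _ _ → pred) idᶜ (compᶜ predᶜ arg₃) (λ _ → refl)
       (λ a m → sym (pred[m∸n]≡m∸[1+n] a m))

-- The recursion is ⌊(m + 1)/2⌋ = ⌈m/2⌉ = m - ⌊m/2⌋.
⌊/2⌋ᶜ : Computable ⌊_/2⌋
⌊/2⌋ᶜ = iterᶜ ⌊_/2⌋ _∸_ ∸ᶜ λ m → trans (sym (m+n∸m≡n ⌊ m /2⌋ _)) (cong (_∸ ⌊ m /2⌋) (⌊n/2⌋+⌈n/2⌉≡n m))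

%2ᶜ : Computable (_% 2)
%2ᶜ = iterᶜ (_% 2) (λ _ v → 1 ∸ v) (app₂ _∸_ ∸ᶜ (constᶜ 1) (sndᶜ idᶜ)) alternates
  where
  alternates : ∀ m → suc m % 2 ≡ 1 ∸ m % 2
  alternates 0             = refl
  alternates 1             = refl
  alternates (suc (suc m)) = alternates m

-- Iterated unpairing makes every number code an infinite sequence, so tuples of any length can be
-- read off without storing the length.
drop : ℕ → ℕ → ℕ
drop h zero    = h
drop h (suc n) = π₂ (drop h n)

elem : ℕ → ℕ → ℕ
elem h n = π₁ (drop h n)

dropᶜ : Computable₂ drop
dropᶜ = primrecᶜ drop (λ _ _ → π₂) idᶜ (sndᶜ arg₃) (λ _ → refl) (λ _ _ → refl)

elemᶜ : Computable₂ elem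
elemᶜ = fstᶜ dropᶜ

-- Recursive predicates

-- Truth is the value 0: conjunctions and bounded universal quantifiers become sums, and
-- minimisation can search for a witness.
record Recursive (R : Pred ℕ 0ℓ) : Set where
  field
    char     : ℕ → ℕ
    charᶜ    : Computable char
    char-⇔   : ∀ x → char x ≡ 0 ⇔ R x

  decide : ∀ x → Dec (R x)
  decide x = map′ (to (char-⇔ x)) (from (char-⇔ x)) (char x ≟ 0)

open Recursive

Recursive₂ : (ℕ → ℕ → Set) → Set
Recursive₂ R = Recursive (λ z → R (π₁ z) (π₂ z))

Recursive₃ : (ℕ → ℕ → ℕ → Set) → Set
Recursive₃ R = Recursive (λ z → R (π₁ z) (π₁ (π₂ z)) (π₂ (π₂ z)))

private
  variable
    R S : Pred ℕ 0ℓ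

Recursive-resp : (∀ x → R x ⇔ S x) → Recursive R → Recursive S
Recursive-resp eq r = record
  { char = char r ; charᶜ = charᶜ r
  ; char-⇔ = λ x → mk⇔ (to (eq x) ∘ to (char-⇔ r x)) (from (char-⇔ r x) ∘ from (eq x)) }

∘ᴿ : Recursive R → Computable f → Recursive (R ∘ f)
∘ᴿ {f = f} r c = record { char = char r ∘ f ; charᶜ = compᶜ (charᶜ r) c ; char-⇔ = char-⇔ r ∘ f }

app₂ᴿ : ∀ (R : ℕ → ℕ → Set) → Recursive₂ R → Computable f → Computable g → Recursive (λ x → R (f x) (g x))
app₂ᴿ {f} {g} R r c d = Recursive-resp
  (λ x → subst (λ p → R (proj₁ p) (proj₂ p) ⇔ R (f x) (g x)) (sym (unpair-⟨,⟩ (f x) (g x))) (mk⇔ (λ p → p) (λ p → p)))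
  (∘ᴿ r (pairᶜ c d))

app₃ᴿ : ∀ (R : ℕ → ℕ → ℕ → Set) → Recursive₃ R → Computable f → Computable g → Computable h →
        Recursive (λ x → R (f x) (g x) (h x))
app₃ᴿ {f} {g} {h} R r c d e = Recursive-resp
  (λ x → subst (λ p → R (f x) (proj₁ p) (proj₂ p) ⇔ R (f x) (g x) (h x)) (sym (unpair-⟨,⟩ (g x) (h x)))
            (mk⇔ (λ p → p) (λ p → p)))
  (app₂ᴿ (λ a b → R a (π₁ b) (π₂ b)) r c (pairᶜ d e))

≤ᴿ : Computable f → Computable g → Recursive (λ x → f x ≤ g x)
≤ᴿ c d = record
  { charᶜ = app₂ _∸_ ∸ᶜ c d ; char-⇔ = λ x → mk⇔ m∸n≡0⇒m≤n m≤n⇒m∸n≡0 }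

<ᴿ : Computable f → Computable g → Recursive (λ x → f x < g x)
<ᴿ c d = ≤ᴿ (sucᶜ c) d

×ᴿ : Recursive R → Recursive S → Recursive (λ x → R x × S x)
×ᴿ r s = record
  { char = λ x → char r x + char s x
  ; charᶜ = app₂ _+_ +ᶜ (charᶜ r) (charᶜ s)
  ; char-⇔ = λ x → mk⇔
      (λ eq → to (char-⇔ r x) (m+n≡0⇒m≡0 _ eq) , to (char-⇔ s x) (m+n≡0⇒n≡0 (char r x) eq))
      (λ (p , q) → cong₂ _+_ (from (char-⇔ r x) p) (from (char-⇔ s x) q)) }

≡ᴿ : Computable f → Computable g → Recursive (λ x → f x ≡ g x)
≡ᴿ c d = Recursive-resp
  (λ x → mk⇔ (λ (p , q) → ≤-antisym p q) (λ p → ≤-reflexive p , ≤-reflexive (sym p)))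
  (×ᴿ (≤ᴿ c d) (≤ᴿ d c))

¬ᴿ : Recursive R → Recursive (λ x → ¬ R x)
¬ᴿ r = record
  { char = λ x → 1 ∸ char r x
  ; charᶜ = app₂ _∸_ ∸ᶜ (constᶜ 1) (charᶜ r)
  ; char-⇔ = λ x → mk⇔
      (λ eq p → 1+n≢0 (trans (cong (1 ∸_) (sym (from (char-⇔ r x) p))) eq))
      (λ ¬p → m≤n⇒m∸n≡0 (n≢0⇒n>0 (¬p ∘ to (char-⇔ r x)))) }

⊎ᴿ : Recursive R → Recursive S → Recursive (λ x → R x ⊎ S x)
⊎ᴿ {R} {S} r s = Recursive-resp de-morgan (¬ᴿ (×ᴿ (¬ᴿ r) (¬ᴿ s)))
  where
  de-morgan : ∀ x → (¬ (¬ R x × ¬ S x)) ⇔ (R x ⊎ S x)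
  de-morgan x with decide r x | decide s x
  ... | yes p | _     = mk⇔ (λ _ → inj₁ p) (λ _ (¬p , _) → ¬p p)
  ... | no ¬p | yes q = mk⇔ (λ _ → inj₂ q) (λ _ (_ , ¬q) → ¬q q)
  ... | no ¬p | no ¬q = mk⇔ (λ k → ⊥-elim (k (¬p , ¬q))) λ { (inj₁ p) (¬p , _) → ¬p p ; (inj₂ q) (_ , ¬q) → ¬q q }

→ᴿ : Recursive R → Recursive S → Recursive (λ x → R x → S x)
→ᴿ {R} {S} r s = Recursive-resp implication (⊎ᴿ (¬ᴿ r) s)
  where
  implication : ∀ x → (¬ R x ⊎ S x) ⇔ (R x → S x)
  implication x with decide r x
  ... | yes p = mk⇔ (λ { (inj₁ ¬p) → ⊥-elim ∘ ¬p ; (inj₂ q) _ → q }) (λ k → inj₂ (k p))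
  ... | no ¬p = mk⇔ (λ _ → ⊥-elim ∘ ¬p) (λ _ → inj₁ ¬p)

-- A definition by cases on `f x` does not reduce for an open `x`. With `suc (pred (f x))` the
-- successor case does, and the guard `0 < f x` makes it the right number.
caseᴿ : ∀ (R : ℕ → ℕ → Set) → Computable f → Recursive (R 0) → Recursive (λ x → R (suc (pred (f x))) x) →
        Recursive (λ x → R (f x) x)
caseᴿ {f} R c r s = Recursive-resp cases
  (⊎ᴿ (×ᴿ (≤ᴿ c zeroᶜ) r) (×ᴿ (<ᴿ zeroᶜ c) s))
  where
  cases : ∀ x → ((f x ≤ 0 × R 0 x) ⊎ (0 < f x × R (suc (pred (f x))) x)) ⇔ R (f x) x
  cases x with f x
  ... | zero  = mk⇔ (λ { (inj₁ (_ , p)) → p ; (inj₂ (() , _)) }) (λ p → inj₁ (z≤n , p))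
  ... | suc n = mk⇔ (λ { (inj₁ (() , _)) ; (inj₂ (_ , p)) → p }) (λ p → inj₂ (s≤s z≤n , p))

∀<ᴿ : ∀ (R : ℕ → ℕ → Set) → Recursive₂ R → Computable f → Recursive (λ x → ∀ i → i < f x → R x i)
∀<ᴿ {f} R r c = record
  { char = λ x → total x (f x)
  ; charᶜ = app₂ total totalᶜ idᶜ c
  ; char-⇔ = λ x → mk⇔ (to′ x (f x)) (from′ x (f x)) }
  where
  total : ℕ → ℕ → ℕ
  total x zero    = 0
  total x (suc n) = char r ⟨ x , n ⟩ + total x n
  totalᶜ : Computable₂ total
  totalᶜ = primrecᶜ total (λ x n v → char r ⟨ x , n ⟩ + v) zeroᶜ
    (app₂ _+_ +ᶜ (compᶜ (charᶜ r) (pairᶜ (fstᶜ idᶜ) (fstᶜ (sndᶜ idᶜ)))) (sndᶜ (sndᶜ idᶜ)))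
    (λ _ → refl) (λ _ _ → refl)
  char-pair : ∀ x n → char r ⟨ x , n ⟩ ≡ 0 ⇔ R x n
  char-pair x n with e ← char-⇔ r ⟨ x , n ⟩ rewrite unpair-⟨,⟩ x n = e
  to′ : ∀ x n → total x n ≡ 0 → ∀ i → i < n → R x i
  to′ x (suc n) eq i i<1+n with m<1+n⇒m<n∨m≡n i<1+n
  ... | inj₁ i<n  = to′ x n (m+n≡0⇒n≡0 (char r ⟨ x , n ⟩) eq) i i<n
  ... | inj₂ refl = to (char-pair x n) (m+n≡0⇒m≡0 _ eq)
  from′ : ∀ x n → (∀ i → i < n → R x i) → total x n ≡ 0
  from′ x zero    p = refl
  from′ x (suc n) p = cong₂ _+_ (from (char-pair x n) (p n ≤-refl)) (from′ x n (λ i i<n → p i (m≤n⇒m≤1+n i<n)))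

∃<ᴿ : ∀ (R : ℕ → ℕ → Set) → Recursive₂ R → Computable f → Recursive (λ x → ∃[ i ] (i < f x × R x i))
∃<ᴿ {f} R r c = Recursive-resp equivalence (¬ᴿ (∀<ᴿ (λ x i → ¬ R x i) (¬ᴿ r) c))
  where
  search< : ∀ x n → ¬ (∀ i → i < n → ¬ R x i) → ∃[ i ] (i < n × R x i)
  search< x zero    k = ⊥-elim (k (λ _ ()))
  search< x (suc n) k with decide (app₂ᴿ R r (constᶜ x) (constᶜ n)) 0
  ... | yes p = n , ≤-refl , p
  ... | no ¬p with i , i<n , p ← search< x n (λ none → k λ i i<1+n q →
                  [ (λ i<n → none i i<n q) , (λ { refl → ¬p q }) ]′ (m<1+n⇒m<n∨m≡n i<1+n))
              = i , m≤n⇒m≤1+n i<n , p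
  equivalence : ∀ x → (¬ (∀ i → i < f x → ¬ R x i)) ⇔ (∃[ i ] (i < f x × R x i))
  equivalence x = mk⇔ (search< x (f x)) (λ (i , i<n , p) none → none i i<n p)

∃ᴿ : ∀ (R : ℕ → ℕ → Set) → Recursive₂ R → Computable f → (∀ {x i} → R x i → i < f x) → Recursive (λ x → ∃[ i ] R x i)
∃ᴿ R r c bounded = Recursive-resp (λ x → mk⇔ (map₂ proj₂) (map₂ (λ p → bounded p , p))) (∃<ᴿ R r c)

-- The values at 0, …, k − 1, most recent first, are stored in h.
entry : (h k i : ℕ) → ℕ
entry h k i = elem h (k ∸ suc i)

entryᶜ : Computable f → Computable g → Computable h → Computable (λ x → entry (f x) (g x) (h x))
entryᶜ c d e = app₂ elem elemᶜ c (app₂ _∸_ ∸ᶜ d (sucᶜ e))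

-- Primitive recursion carries all earlier values along in the one number `h`. As `step` relies only
-- on entries below `k`, strong induction shows every value correct.
course-of-valuesᴿ : ∀ (Body : ℕ → ℕ → Set) → Recursive₂ Body →
  (∀ k h → (∀ i → i < k → entry h k i ≡ 0 ⇔ R i) → Body k h ⇔ R k) → Recursive R
course-of-valuesᴿ {R} Body r step = record
  { char = value
  ; charᶜ = compᶜ (charᶜ r) (pairᶜ idᶜ (iterᶜ history (λ k h → ⟨ char r ⟨ k , h ⟩ , h ⟩)
      (pairᶜ (compᶜ (charᶜ r) (pairᶜ (fstᶜ idᶜ) (sndᶜ idᶜ))) (sndᶜ idᶜ)) (λ _ → refl)))
  ; char-⇔ = <-rec _ correct }
  where
  history : ℕ → ℕ
  history zero    = 0
  history (suc k) = ⟨ char r ⟨ k , history k ⟩ , history k ⟩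
  value : ℕ → ℕ
  value k = char r ⟨ k , history k ⟩
  drop-history : ∀ n k → drop (history (n + k)) n ≡ history k
  drop-history zero    k = refl
  drop-history (suc n) k = trans
    (cong π₂ (trans (cong (λ m → drop (history m) n) (sym (+-suc n k))) (drop-history n (suc k))))
    (π₂-⟨,⟩ (value k) (history k))
  entry-history : ∀ k i → i < k → entry (history k) k i ≡ value i
  entry-history k i i<k = trans
    (cong π₁ (trans (cong (λ n → drop (history n) (k ∸ suc i)) (sym (m∸n+n≡m i<k))) (drop-history (k ∸ suc i) (suc i))))
    (π₁-⟨,⟩ (value i) (history i))
  correct : ∀ k → (∀ {i} → i < k → value i ≡ 0 ⇔ R i) → value k ≡ 0 ⇔ R k
  correct k ih = mk⇔ (to now ∘ to char-k) (from char-k ∘ from now)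
    where
    now : Body k (history k) ⇔ R k
    now = step k (history k) λ i i<k → subst (λ v → v ≡ 0 ⇔ R i) (sym (entry-history k i i<k)) (ih i<k)
    char-k : value k ≡ 0 ⇔ Body k (history k)
    char-k with e ← char-⇔ r ⟨ k , history k ⟩ rewrite unpair-⟨,⟩ k (history k) = e

-- The decision need not be effective: its finitely many answers are built into the characteristic
-- function.
finiteᴿ : (∀ x → Dec (R x)) → ∀ n → Recursive (λ x → x < n × R x)
finiteᴿ R? zero = Recursive-resp (λ x → mk⇔ (λ ()) (λ ())) (<ᴿ idᶜ zeroᶜ)
finiteᴿ R? (suc n) with R? n
... | yes p = Recursive-resp (λ x → mk⇔
        (λ { (inj₁ (x<n , q)) → m≤n⇒m≤1+n x<n , q ; (inj₂ refl) → ≤-refl , p })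
        (λ (x<1+n , q) → [ (λ x<n → inj₁ (x<n , q)) , inj₂ ]′ (m<1+n⇒m<n∨m≡n x<1+n)))
        (⊎ᴿ (finiteᴿ R? n) (≡ᴿ idᶜ (constᶜ n)))
... | no ¬p = Recursive-resp (λ x → mk⇔
        (λ (x<n , q) → m≤n⇒m≤1+n x<n , q)
        (λ (x<1+n , q) → [ (λ x<n → x<n , q) , (λ { refl → ⊥-elim (¬p q) }) ]′ (m<1+n⇒m<n∨m≡n x<1+n)))
        (finiteᴿ R? n)

-- Indices of c.e. sets

Eval⇒W : ∀ {e x y} → Eval e x y → x ∈ W e
Eval⇒W {x = x} {y} (s , p) = s ⊔ suc x , m≤n⊔m s (suc x) , y , Run-mono (m≤m⊔n s _) p

W⇒Eval : ∀ {e x} → x ∈ W e → ∃[ y ] Eval e x y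
W⇒Eval (s , _ , y , p) = y , s , p

-- The index searches for a witness by minimisation. Each failed trial costs one more level of
-- nesting, so a witness found within `s` levels is at most `s`.
projection : ∀ (R : ℕ → ℕ → Set) → Recursive₂ R →
  ∃[ e ] ((∀ {x k} → R x k → ∃[ y ] Eval e x y) × (∀ s x y → Run s e x y → R x y × y ≤ s))
projection R r = compᵉ (minᵉ c) (pairᵉ i zeroᵉ) , halts , bounded
  where
  c = proj₁ (charᶜ r)
  c-eval = proj₂ (charᶜ r)
  i = proj₁ idᶜ
  pair-eval : ∀ x → Eval (pairᵉ i zeroᵉ) x ⟨ x , 0 ⟩
  pair-eval = proj₂ (pairᶜ idᶜ zeroᶜ)
  char-pair : ∀ x n → R x n → char r ⟨ x , n ⟩ ≡ 0
  char-pair x n p = from (char-⇔ r ⟨ x , n ⟩)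
    (subst (λ q → R (proj₁ q) (proj₂ q)) (sym (unpair-⟨,⟩ x n)) p)
  -- `m` is the distance from the current trial `k` to a known witness.
  min-halts : ∀ m x k → R x (m + k) → ∃[ y ] Eval (minᵉ c) ⟨ x , k ⟩ y
  min-halts m x k p with char r ⟨ x , k ⟩ in eq
  ... | zero = k , eval (schema-minᵉ c)
        (0 , subst (Eval c _) eq (c-eval _) , sym (π₂-⟨,⟩ x k))
  min-halts zero x k p | suc v with () ← trans (sym eq) (char-pair x k p)
  min-halts (suc m) x k p | suc v
    with y , q ← min-halts m x (suc k) (subst (R x) (sym (+-suc m k)) p)
    = y , eval (schema-minᵉ c) (suc v , subst (Eval c _) eq (c-eval _) ,
        subst₂ (λ a b → Eval (minᵉ c) ⟨ a , suc b ⟩ y) (sym (π₁-⟨,⟩ x k)) (sym (π₂-⟨,⟩ x k)) q)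
  halts : ∀ {x k} → R x k → ∃[ y ] Eval (compᵉ (minᵉ c) (pairᵉ i zeroᵉ)) x y
  halts {x} {k} p with y , q ← min-halts k x 0 (subst (R x) (sym (+-identityʳ k)) p)
    = y , eval (schema-compᵉ (minᵉ c) (pairᵉ i zeroᵉ)) (_ , pair-eval x , q)
  min-bounded : ∀ s z y → Run s (minᵉ c) z y → R (π₁ z) y × y ≤ π₂ z + s
  min-bounded (suc s) z y p with Run⇒Unfolds s (minᵉ c) z (schema-minᵉ c) p
  ... | zero , q , refl = to (char-⇔ r z) (sym (Eval-unique (s , q) (c-eval z))) , m≤m+n _ _
  ... | suc v , q , p′ with R-y , y≤ ← min-bounded s ⟨ π₁ z , suc (π₂ z) ⟩ y p′
    rewrite unpair-⟨,⟩ (π₁ z) (suc (π₂ z)) = R-y , subst (y ≤_) (sym (+-suc (π₂ z) s)) y≤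
  bounded : ∀ s x y → Run s (compᵉ (minᵉ c) (pairᵉ i zeroᵉ)) x y → R x y × y ≤ s
  bounded (suc s) x y p
    with z , q , p′ ← Run⇒Unfolds s (compᵉ (minᵉ c) (pairᵉ i zeroᵉ)) x (schema-compᵉ (minᵉ c) (pairᵉ i zeroᵉ)) p
    with refl ← Eval-unique (s , q) (pair-eval x)
    with R-y , y≤ ← min-bounded s ⟨ x , 0 ⟩ y p′
    rewrite unpair-⟨,⟩ x 0 = R-y , m≤n⇒m≤1+n y≤

opaque
  -- This predecessor is undefined at 0, where the search never ends.
  predecessorᵉ : ℕ
  predecessorᵉ = proj₁ (projection (λ x k → suc k ≡ x) (≡ᴿ (sucᶜ (sndᶜ idᶜ)) (fstᶜ idᶜ)))

  predecessor-sound : ∀ {x y} → Eval predecessorᵉ x y → suc y ≡ x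
  predecessor-sound {x} {y} (s , p) =
    proj₁ (proj₂ (proj₂ (projection (λ x k → suc k ≡ x) (≡ᴿ (sucᶜ (sndᶜ idᶜ)) (fstᶜ idᶜ)))) s x y p)

  predecessor-complete : ∀ x → ∃[ y ] Eval predecessorᵉ (suc x) y
  predecessor-complete x =
    proj₁ (proj₂ (projection (λ x k → suc k ≡ x) (≡ᴿ (sucᶜ (sndᶜ idᶜ)) (fstᶜ idᶜ)))) refl

-- guard M is an index of a function with domain [ M , ∞ ).
guard : ℕ → ℕ
guard zero    = zeroᵉ
guard (suc M) = compᵉ (guard M) predecessorᵉ

guardᶜ : Computable guard
guardᶜ = iterᶜ guard (λ _ v → compᵉ v predecessorᵉ) (compᵉᶜ (sndᶜ idᶜ) (constᶜ _)) (λ _ → refl)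

guard-sound : ∀ M {x y} → Eval (guard M) x y → M ≤ x
guard-sound zero    p = z≤n
guard-sound (suc M) {x} p
  with z , q , p′ ← uneval {x = x} (schema-compᵉ (guard M) predecessorᵉ) p
  with refl ← predecessor-sound q = s≤s (guard-sound M p′)

guard-complete : ∀ M {x} → M ≤ x → ∃[ y ] Eval (guard M) x y
guard-complete zero    M≤x = 0 , eval schema-zeroᵉ refl
guard-complete (suc M) {suc x} (s≤s M≤x)
  with y , p ← guard-complete M M≤x
  with z , q ← predecessor-complete x
  with refl ← predecessor-sound q
  = y , eval (schema-compᵉ (guard M) predecessorᵉ) (x , q , p)

restrict : ℕ → ℕ → ℕ
restrict M e = pairᵉ (guard M) e

restrict-W⇒ : ∀ {M e x} → x ∈ W (restrict M e) → M ≤ x × x ∈ W e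
restrict-W⇒ {M} {e} {x} p with y , q ← W⇒Eval p with q₁ , q₂ ← uneval {x = x} (schema-pairᵉ (guard M) e) q
  = guard-sound M q₁ , Eval⇒W q₂

restrict-W⇐ : ∀ {M e x} → M ≤ x → x ∈ W e → ∃[ y ] Eval (restrict M e) x y
restrict-W⇐ {M} {e} {x} M≤x p with u , p₁ ← guard-complete M M≤x | v , p₂ ← W⇒Eval p
  = ⟨ u , v ⟩ , eval (schema-pairᵉ (guard M) e)
      (subst (Eval (guard M) x) (sym (π₁-⟨,⟩ u v)) p₁ , subst (Eval e x) (sym (π₂-⟨,⟩ u v)) p₂)

-- A recursive simulation of all partial recursive functions

-- A fact is a number ⟨ ⟨ e , x ⟩ , y ⟩, asserting that the e-th function maps
-- x to y.  Stage i of the simulation derives the fact π₁ i, if it is an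
-- unfolding of facts derived at earlier stages.

Fact : (ℕ → Set) → ℕ → ℕ → ℕ → Set
Fact P e x y = P ⟨ ⟨ e , x ⟩ , y ⟩

Derivable : (ℕ → Set) → ℕ → Set
Derivable P t = Unfolds (Fact P) (π₁ (π₁ t)) (π₂ (π₁ t)) (π₂ t) (schema (π₁ (π₁ t)))

Derivable-map : ∀ (P Q : ℕ → Set) → (∀ {t} → P t → Q t) → ∀ t → Derivable P t → Derivable Q t
Derivable-map P Q h t = Unfolds-map h (schema (π₁ (π₁ t)))

Before : (ℕ → Set) → ℕ → ℕ → Set
Before P s t = ∃[ i ] (i < s × π₁ i ≡ t × P i)

data Derived : ℕ → Set where
  derive : ∀ {s} → Derivable (Before Derived s) (π₁ s) → Derived s

-- Premises stem from strictly earlier stages, so the nesting of the evaluation never exceeds the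
-- number of stages. The simulation is thus never ahead of `run`.
Derived⇒Run : ∀ s {i} → i < s → Derived i → Run s (π₁ (π₁ (π₁ i))) (π₂ (π₁ (π₁ i))) (π₂ (π₁ i))
Derived⇒Run (suc s) {i} (s≤s i≤s) (derive p) = Unfolds⇒unfold σ (Unfolds-map run-fact σ p)
  where
  σ = schema (π₁ (π₁ (π₁ i)))
  run-fact : ∀ {e x y} → Fact (Before Derived i) e x y → Run s e x y
  run-fact {e} {x} {y} (k , k<i , eq , d) with p ← Derived⇒Run s (<-≤-trans k<i i≤s) d
    rewrite eq | unpair-⟨,⟩ ⟨ e , x ⟩ y | unpair-⟨,⟩ e x = p

Before-mono : ∀ {P s s′ t} → s ≤ s′ → Before P s t → Before P s′ t
Before-mono s≤s′ (i , i<s , p) = i , <-≤-trans i<s s≤s′ , p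

Run⇒Before : ∀ s {e x y} → Run s e x y → ∃[ b ] Fact (Before Derived b) e x y
Run⇒Before (suc s) {e} {x} {y} p
  with b , q ← Unfolds-bound {λ b → Fact (Before Derived b)} Before-mono (schema e)
                 (Unfolds-map (Run⇒Before s) (schema e) (unfold⇒Unfolds (schema e) p))
  = suc i , i , ≤-refl , π₁-⟨,⟩ t b , derive derivable
  where
  t = ⟨ ⟨ e , x ⟩ , y ⟩
  -- Each fact comes up at infinitely many stages; this one is at least `b`, when the premises have
  -- been derived.
  i = ⟨ t , b ⟩
  derivable : Derivable (Before Derived i) (π₁ i)
  derivable rewrite π₁-⟨,⟩ t b | unpair-⟨,⟩ ⟨ e , x ⟩ y | unpair-⟨,⟩ e x =
    Unfolds-map (Before-mono (y≤⟨x,y⟩ t b)) (schema e) q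

-- The cases follow `decode`. The intermediate value in a composition, recursion or search is at
-- most the code of a fact in `P w`, so the search for it is bounded by `b w`.
Derivableᴿ : ∀ (P : ℕ → ℕ → Set) {b t} → Recursive₂ P → Computable b → (∀ {w u} → P w u → u < b w) →
             Computable t → Recursive (λ w → Derivable (P w) (t w))
Derivableᴿ P {b} {t} r bᶜ bounded tᶜ =
  case 0 tag (≡ᴿ y zeroᶜ)
 (case 1 tag₁ (≡ᴿ y (sucᶜ x))
 (case 2 tag₂ (≡ᴿ y (fstᶜ x))
 (case 3 tag₃ (≡ᴿ y (sndᶜ x))
 (case 4 tag₄ (×ᴿ (fact idᶜ (fstᶜ m) x (fstᶜ y)) (fact idᶜ (sndᶜ m) x (sndᶜ y)))
 (case 5 tag₅ (∃ᴿ (λ w z → Fact (P w) (π₂ (m′ w)) (x′ w) z × Fact (P w) (π₁ (m′ w)) z (y′ w))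
              (×ᴿ (fact out (sndᶜ (up m)) (up x) new) (fact out (fstᶜ (up m)) new (up y)))
              bᶜ (λ {w} → value< w (π₂ (m′ w)) (x′ w) ∘ proj₁))
 (case 6 tag₆ (caseᴿ (λ k w → Recurses (Fact (P w)) (e′ w) (π₁ (m′ w)) (π₂ (m′ w)) (π₁ (x′ w)) k (y′ w))
              (sndᶜ x)
              (fact idᶜ (fstᶜ m) (fstᶜ x) y)
              (∃ᴿ (λ w z → Fact (P w) (e′ w) ⟨ π₁ (x′ w) , pred (π₂ (x′ w)) ⟩ z ×
                           Fact (P w) (π₂ (m′ w)) ⟨ π₁ (x′ w) , ⟨ pred (π₂ (x′ w)) , z ⟩ ⟩ (y′ w))
                (×ᴿ (fact out (up e) (pairᶜ (fstᶜ (up x)) (compᶜ predᶜ (sndᶜ (up x)))) new)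
                    (fact out (sndᶜ (up m)) (pairᶜ (fstᶜ (up x)) (pairᶜ (compᶜ predᶜ (sndᶜ (up x))) new)) (up y)))
                bᶜ (λ {w} → value< w (e′ w) ⟨ π₁ (x′ w) , pred (π₂ (x′ w)) ⟩ ∘ proj₁)))
 (∃ᴿ (λ w v → Fact (P w) (m′ w) (x′ w) v × Searches (Fact (P w)) (e′ w) (π₁ (x′ w)) (π₂ (x′ w)) (y′ w) v)
   (×ᴿ (fact out (up m) (up x) new)
       (caseᴿ (λ v w → Searches (Fact (P (π₁ w))) (e′ (π₁ w)) (π₁ (x′ (π₁ w))) (π₂ (x′ (π₁ w))) (y′ (π₁ w)) v)
         new
         (≡ᴿ (up y) (sndᶜ (up x)))
         (fact out (up e) (pairᶜ (fstᶜ (up x)) (sucᶜ (sndᶜ (up x)))) (up y))))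
   bᶜ (λ {w} → value< w (m′ w) (x′ w) ∘ proj₁))))))))
  where
  e′ x′ y′ m′ : ℕ → ℕ
  e′ w = π₁ (π₁ (t w))
  x′ w = π₂ (π₁ (t w))
  y′ w = π₂ (t w)
  m′ w = π₂ (e′ w)
  e : Computable e′
  e = fstᶜ (fstᶜ tᶜ)
  x : Computable x′
  x = sndᶜ (fstᶜ tᶜ)
  y : Computable y′
  y = sndᶜ tᶜ
  m : Computable m′
  m = sndᶜ e
  tag : Computable (λ w → π₁ (e′ w))
  tag = fstᶜ e
  out : Computable π₁
  out = fstᶜ idᶜ
  new : Computable π₂
  new = sndᶜ idᶜ
  up : ∀ {f} → Computable f → Computable (λ w → f (π₁ w))
  up c = compᶜ c out
  fact : ∀ {c f x y} → Computable c → Computable f → Computable x → Computable y →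
         Recursive (λ w → Fact (P (c w)) (f w) (x w) (y w))
  fact c f x y = app₂ᴿ P r c (pairᶜ (pairᶜ f x) y)
  tag₁ = compᶜ predᶜ tag
  tag₂ = compᶜ predᶜ tag₁
  tag₃ = compᶜ predᶜ tag₂
  tag₄ = compᶜ predᶜ tag₃
  tag₅ = compᶜ predᶜ tag₄
  tag₆ = compᶜ predᶜ tag₅
  value< : ∀ w f x {z} → Fact (P w) f x z → z < b w
  value< w f x {z} p = ≤-<-trans (y≤⟨x,y⟩ ⟨ f , x ⟩ z) (bounded p)
  case : ∀ k {f} → Computable f →
         Recursive (λ w → Unfolds (Fact (P w)) (e′ w) (x′ w) (y′ w) (decode (k + 0) (m′ w))) →
         Recursive (λ w → Unfolds (Fact (P w)) (e′ w) (x′ w) (y′ w) (decode (k + suc (pred (f w))) (m′ w))) →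
         Recursive (λ w → Unfolds (Fact (P w)) (e′ w) (x′ w) (y′ w) (decode (k + f w) (m′ w)))
  case k = caseᴿ (λ n w → Unfolds (Fact (P w)) (e′ w) (x′ w) (y′ w) (decode (k + n) (m′ w)))

Derivedᴿ : Recursive Derived
Derivedᴿ = course-of-valuesᴿ (λ k h → Derivable (Recorded k h) (π₁ k))
  (Derivableᴿ (λ w → Recorded (π₁ w) (π₂ w))
    (∃<ᴿ (λ z i → π₁ i ≡ π₂ z × entry (π₂ (π₁ z)) (π₁ (π₁ z)) i ≡ 0)
      (×ᴿ (≡ᴿ (fstᶜ new) (sndᶜ old)) (≡ᴿ (entryᶜ (sndᶜ (fstᶜ old)) (fstᶜ (fstᶜ old)) new) zeroᶜ))
      (fstᶜ old))
    old
    (λ { (i , i<k , refl , _) → ≤-<-trans (π₁-≤ i) i<k })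
    (fstᶜ old))
  λ k h agree → mk⇔
    (λ p → derive (Derivable-map (Recorded k h) (Before Derived k)
      (λ (i , i<k , eq , q) → i , i<k , eq , to (agree i i<k) q) (π₁ k) p))
    (λ { (derive p) → Derivable-map (Before Derived k) (Recorded k h)
      (λ (i , i<k , eq , q) → i , i<k , eq , from (agree i i<k) q) (π₁ k) p })
  where
  old : Computable π₁
  old = fstᶜ idᶜ
  new : Computable π₂
  new = sndᶜ idᶜ
  Recorded : ℕ → ℕ → ℕ → Set
  Recorded k h = Before (λ i → entry h k i ≡ 0) k

uniform-bound : ∀ {P : ℕ → ℕ → Set} → (∀ {i s t} → s ≤ t → P i s → P i t) →
                ∀ n → (∀ i → i < n → ∃[ s ] P i s) → ∃[ s ] (∀ i → i < n → P i s)
uniform-bound mono zero    p = 0 , λ _ ()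
uniform-bound {P} mono (suc n) p
  with s , q ← p n ≤-refl | t , r ← uniform-bound {P} mono n (λ i i<n → p i (m≤n⇒m≤1+n i<n))
  = s ⊔ t , λ i i<1+n → [ (λ i<n → mono (m≤n⊔m s t) (r i i<n)) , (λ { refl → mono (m≤m⊔n s t) q }) ]′
                          (m<1+n⇒m<n∨m≡n i<1+n)

-- Seen e s is a recursive approximation of W e that is slow enough for every
-- W[ restrict M e , s ] to contain its members ≥ M: cutting W e at M then
-- causes no delay.
opaque
  Seen : ℕ → ℕ → ℕ → Set
  Seen e s x = ∀ M → M < suc x → ∃[ i ] (i < s × Derived i × π₁ (π₁ i) ≡ ⟨ restrict M e , x ⟩)

  Seenᴿ : Recursive₃ Seen
  Seenᴿ = ∀<ᴿ (λ w M → ∃[ i ] (i < π₁ (π₂ w) × Derived i × π₁ (π₁ i) ≡ ⟨ restrict M (π₁ w) , π₂ (π₂ w) ⟩))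
    (∃<ᴿ (λ w i → Derived i × π₁ (π₁ i) ≡ ⟨ restrict (π₂ w) (π₁ (π₁ w)) , π₂ (π₂ (π₁ w)) ⟩)
      (×ᴿ (∘ᴿ Derivedᴿ (sndᶜ idᶜ))
          (≡ᴿ (fstᶜ (fstᶜ (sndᶜ idᶜ)))
              (pairᶜ (pairᵉᶜ (compᶜ guardᶜ (sndᶜ (fstᶜ idᶜ))) (fstᶜ (fstᶜ (fstᶜ idᶜ)))) (sndᶜ (sndᶜ (fstᶜ (fstᶜ idᶜ)))))))
      (fstᶜ (sndᶜ (fstᶜ idᶜ))))
    (sucᶜ (sndᶜ (sndᶜ idᶜ)))

  Seen-mono : ∀ {e s t x} → s ≤ t → Seen e s x → Seen e t x
  Seen-mono s≤t p M M≤x with i , i<s , q ← p M M≤x = i , <-≤-trans i<s s≤t , q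

  Seen⇒W[] : ∀ {e s x M} → M ≤ x → Seen e s x → x ∈ W[ restrict M e , s ]
  Seen⇒W[] {e} {s} {x} {M} M≤x p with i , i<s , d , eq ← p M (s≤s M≤x) =
    -- The bound `x < s` holds because `x` is a component of the code `i`.
    ≤-<-trans (≤-trans (y≤⟨x,y⟩ (restrict M e) x) (subst (_≤ i) eq (≤-trans (π₁-≤ (π₁ i)) (π₁-≤ i)))) i<s ,
    π₂ (π₁ i) , run-restrict
    where
    run-restrict : Run s (restrict M e) x (π₂ (π₁ i))
    run-restrict with q ← Derived⇒Run s i<s d rewrite eq | unpair-⟨,⟩ (restrict M e) x = q

  Seen⇒W : ∀ {e s x} → Seen e s x → x ∈ W e
  Seen⇒W {s = s} p = proj₂ (restrict-W⇒ {0} (s , Seen⇒W[] z≤n p))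

  W⇒Seen : ∀ {e x} → x ∈ W e → ∃[ s ] Seen e s x
  W⇒Seen {e} {x} x∈W = uniform-bound
    (λ s≤t (i , i<s , q) → i , <-≤-trans i<s s≤t , q) (suc x) derived
    where
    derived : ∀ M → M < suc x → ∃[ s ] ∃[ i ] (i < s × Derived i × π₁ (π₁ i) ≡ ⟨ restrict M e , x ⟩)
    derived M (s≤s M≤x)
      with y , s , p ← restrict-W⇐ M≤x x∈W
      with b , i , i<b , eq , d ← Run⇒Before s p
      = b , i , i<b , d , trans (cong π₁ eq) (π₁-⟨,⟩ _ y)

opaque
  enumeration : ∀ (R : ℕ → ℕ → Set) → Recursive₂ R →
    ∃[ e ] ((∀ {x k} → R x k → x ∈ W e) × (∀ {s x} → x ∈ W[ e , s ] → ∃[ k ] (k ≤ s × R x k)))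
  enumeration R r with e , halts , bounded ← projection R r =
    e , (λ p → Eval⇒W (proj₂ (halts p))) ,
    λ {s} {x} (_ , y , p) → y , proj₂ (bounded s x y p) , proj₁ (bounded s x y p)

-- The construction of the promises

⊥ᴿ : Recursive (λ _ → ⊥)
⊥ᴿ = Recursive-resp (λ _ → mk⇔ (λ ()) ⊥-elim) (<ᴿ zeroᶜ zeroᶜ)

-- α s is an approximation of A, and k the number of pairs of sets in the
-- presentation of ∁ A.  The number n guesses the indices of D₁, …, Dₖ
-- and of T₁, …, Tₖ.
module Construction (α : ℕ → ℕ → Set) (αᴿ : Recursive₂ α) (c k : ℕ) where

  δ τ : ℕ → ℕ → ℕ
  δ n i = elem (π₁ n) i
  τ n i = elem (π₂ n) i

  -- Adding `α s` keeps the approximation of `A` inside that of `C` at every stage.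
  C : ℕ → ℕ → Set
  C s x = Seen c s x ⊎ α s x

  Late : ℕ → ℕ → ℕ → Set
  Late n s x = ∀ i → i < k → Seen (τ n i) s x → α s x → Seen (δ n i) s x

  Covered : ℕ → ℕ → ℕ → Set
  Covered n s x = α s x ⊎ ∃[ i ] (i < k × Seen (τ n i) s x × ¬ Seen (δ n i) s x)

  Good : ℕ → ℕ → ℕ → Set
  Good n s x = (∀ r → r < suc s → Late n r x) × Covered n s x

  Least : (ℕ → ℕ → Set) → ℕ → ℕ → Set
  Least V n x = V n x × (∀ m → m < n → ¬ V m x)

  Ok : (ℕ → ℕ → Set) → ℕ → ℕ → ℕ → Set
  Ok V n s x = (C s x × ¬ Least V n x) ⊎ Good n s x

  -- The bound `n + x ≤ s` leaves only guesses below the stage to be searched, and forces the stages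
  -- to grow with `x`.
  Long : (ℕ → ℕ → Set) → ℕ → ℕ → ℕ → Set
  Long V n s x = n + x ≤ s × (∀ z → z < suc x → Ok V n s z)

  -- U s n x: before stage s, the guess n looked correct up to x at a stage at
  -- which x was not yet in C.  An element of C belongs to the least such n.
  opaque
    U : ℕ → ℕ → ℕ → Set
    U zero    n x = ⊥
    U (suc s) n x = U s n x ⊎ (¬ C s x × Long (U s) n s x)

    ¬U-zero : ∀ {n x} → ¬ U 0 n x
    ¬U-zero ()

    U-suc : ∀ s n x → U (suc s) n x ⇔ (U s n x ⊎ (¬ C s x × Long (U s) n s x))
    U-suc s n x = mk⇔ (λ p → p) (λ p → p)

  private
    δᶜ : ∀ {f g} → Computable f → Computable g → Computable (λ z → δ (f z) (g z))
    δᶜ c d = app₂ elem elemᶜ (fstᶜ c) d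
    τᶜ : ∀ {f g} → Computable f → Computable g → Computable (λ z → τ (f z) (g z))
    τᶜ c d = app₂ elem elemᶜ (sndᶜ c) d
    out : Computable π₁
    out = fstᶜ idᶜ
    new : Computable π₂
    new = sndᶜ idᶜ
    Seenᴿ′ : ∀ {e s x} → Computable e → Computable s → Computable x → Recursive (λ z → Seen (e z) (s z) (x z))
    Seenᴿ′ = app₃ᴿ Seen Seenᴿ
    αᴿ′ : ∀ {s x} → Computable s → Computable x → Recursive (λ z → α (s z) (x z))
    αᴿ′ = app₂ᴿ α αᴿ

  Cᴿ : Recursive₂ C
  Cᴿ = ⊎ᴿ (Seenᴿ′ (constᶜ c) out new) (αᴿ′ out new)

  Lateᴿ : Recursive₃ Late
  Lateᴿ = ∀<ᴿ (λ z i → Seen (τ (π₁ z) i) (π₁ (π₂ z)) (π₂ (π₂ z)) → α (π₁ (π₂ z)) (π₂ (π₂ z)) →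
                       Seen (δ (π₁ z) i) (π₁ (π₂ z)) (π₂ (π₂ z)))
    (→ᴿ (Seenᴿ′ (τᶜ (fstᶜ out) new) s x) (→ᴿ (αᴿ′ s x) (Seenᴿ′ (δᶜ (fstᶜ out) new) s x)))
    (constᶜ k)
    where
    s : Computable (λ w → π₁ (π₂ (π₁ w)))
    s = fstᶜ (sndᶜ out)
    x : Computable (λ w → π₂ (π₂ (π₁ w)))
    x = sndᶜ (sndᶜ out)

  Coveredᴿ : Recursive₃ Covered
  Coveredᴿ = ⊎ᴿ (αᴿ′ (fstᶜ new) (sndᶜ new))
    (∃<ᴿ (λ z i → Seen (τ (π₁ z) i) (π₁ (π₂ z)) (π₂ (π₂ z)) × ¬ Seen (δ (π₁ z) i) (π₁ (π₂ z)) (π₂ (π₂ z)))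
      (×ᴿ (Seenᴿ′ (τᶜ (fstᶜ out) new) (fstᶜ (sndᶜ out)) (sndᶜ (sndᶜ out)))
          (¬ᴿ (Seenᴿ′ (δᶜ (fstᶜ out) new) (fstᶜ (sndᶜ out)) (sndᶜ (sndᶜ out)))))
      (constᶜ k))

  Goodᴿ : Recursive₃ Good
  Goodᴿ = ×ᴿ
    (∀<ᴿ (λ z r → Late (π₁ z) r (π₂ (π₂ z)))
      (app₃ᴿ Late Lateᴿ (fstᶜ out) new (sndᶜ (sndᶜ out)))
      (sucᶜ (fstᶜ new)))
    Coveredᴿ

  Leastᴿ : ∀ (V : ℕ → ℕ → ℕ → Set) → Recursive₃ V → Recursive₃ (λ w → Least (V w))
  Leastᴿ V r = ×ᴿ r (∀<ᴿ (λ z m → ¬ V (π₁ z) m (π₂ (π₂ z)))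
    (¬ᴿ (app₃ᴿ V r (fstᶜ out) new (sndᶜ (sndᶜ out)))) (fstᶜ new))

  Longᴿ : ∀ (V : ℕ → ℕ → ℕ → Set) {n s x} → Recursive₃ V → Computable n → Computable s → Computable x →
          Recursive (λ w → Long (V w) (n w) (s w) (x w))
  Longᴿ V {n} {s} {x} r nᶜ sᶜ xᶜ = ×ᴿ (≤ᴿ (app₂ _+_ +ᶜ nᶜ xᶜ) sᶜ)
    (∀<ᴿ (λ w z → Ok (V w) (n w) (s w) z)
      (⊎ᴿ (×ᴿ (app₂ᴿ C Cᴿ (compᶜ sᶜ out) new)
              (¬ᴿ (app₃ᴿ (λ w → Least (V w)) (Leastᴿ V r) out (compᶜ nᶜ out) new)))
          (app₃ᴿ Good Goodᴿ (compᶜ nᶜ out) (compᶜ sᶜ out) new))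
      (sucᶜ xᶜ))

  Least-cong : ∀ (V V′ : ℕ → ℕ → Set) {n x} → (∀ m → m ≤ n → V m x ⇔ V′ m x) → Least V n x → Least V′ n x
  Least-cong V V′ eq (v , least) = to (eq _ ≤-refl) v , λ m m<n v′ → least m m<n (from (eq m (<⇒≤ m<n)) v′)

  -- `V` is consulted only about guesses up to `n` and numbers up to `x`. This is what makes `U` a
  -- recursion on smaller codes.
  Long-cong : ∀ (V V′ : ℕ → ℕ → Set) {n s x} → (∀ m z → m ≤ n → z ≤ x → V m z ⇔ V′ m z) →
              Long V n s x → Long V′ n s x
  Long-cong V V′ {n} eq (n+x≤s , ok) = n+x≤s , λ z z≤x → [
    (λ (Cz , ¬least) → inj₁ (Cz , λ least → ¬least (Least-cong V′ V {n} {z} (λ m m≤n →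
      let e = eq m z m≤n (s≤s⁻¹ z≤x) in mk⇔ (from e) (to e)) least))) ,
    inj₂ ]′ (ok z z≤x)

  private
    Coded : ℕ → Set
    Coded u = U (π₂ u) (π₁ (π₁ u)) (π₂ (π₁ u))

    Recorded : ℕ → ℕ → ℕ → ℕ → ℕ → Set
    Recorded u h s n x = entry h u ⟨ ⟨ n , x ⟩ , s ⟩ ≡ 0

    Body : ℕ → ℕ → ℕ → Set
    Body zero    u h = ⊥
    Body (suc s) u h = Recorded u h s (π₁ (π₁ u)) (π₂ (π₁ u)) ⊎
      (¬ C s (π₂ (π₁ u)) × Long (Recorded u h s) (π₁ (π₁ u)) s (π₂ (π₁ u)))

    Bodyᴿ : Recursive₂ (λ u h → Body (π₂ u) u h)
    Bodyᴿ = caseᴿ (λ s w → Body s (π₁ w) (π₂ w)) (sndᶜ out) ⊥ᴿ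
      (⊎ᴿ (recorded idᶜ (fstᶜ (fstᶜ out)) (sndᶜ (fstᶜ out)))
          (×ᴿ (¬ᴿ (app₂ᴿ C Cᴿ s (sndᶜ (fstᶜ out))))
              (Longᴿ (λ w → Recorded (π₁ w) (π₂ w) (pred (π₂ (π₁ w)))) (recorded out (fstᶜ new) (sndᶜ new))
                (fstᶜ (fstᶜ out)) s (sndᶜ (fstᶜ out)))))
      where
      s : Computable (λ w → pred (π₂ (π₁ w)))
      s = compᶜ predᶜ (sndᶜ out)
      recorded : ∀ {w n x} → Computable w → Computable n → Computable x →
                 Recursive (λ z → Recorded (π₁ (w z)) (π₂ (w z)) (pred (π₂ (π₁ (w z)))) (n z) (x z))
      recorded wᶜ nᶜ xᶜ = ≡ᴿ
        (entryᶜ (sndᶜ wᶜ) (fstᶜ wᶜ) (pairᶜ (pairᶜ nᶜ xᶜ) (compᶜ s wᶜ))) zeroᶜ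

    Body-⇔ : ∀ u h → (∀ i → i < u → entry h u i ≡ 0 ⇔ Coded i) → Body (π₂ u) u h ⇔ Coded u
    Body-⇔ u h agree = go (π₂ u) refl
      where
      n = π₁ (π₁ u)
      x = π₂ (π₁ u)
      go : ∀ s → π₂ u ≡ s → Body s u h ⇔ U s n x
      go zero    eq = mk⇔ (λ ()) ¬U-zero
      go (suc s) eq = mk⇔
        (from (U-suc s n x) ∘
          [ inj₁ ∘ to (recorded n x ≤-refl ≤-refl) ,
            (λ (¬C , long) → inj₂ (¬C , Long-cong (Recorded u h s) (U s) recorded long)) ]′)
        ([ inj₁ ∘ from (recorded n x ≤-refl ≤-refl) ,
            (λ (¬C , long) → inj₂ (¬C , Long-cong (U s) (Recorded u h s) (λ m z m≤n z≤x →
              mk⇔ (from (recorded m z m≤n z≤x)) (to (recorded m z m≤n z≤x))) long)) ]′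
          ∘ to (U-suc s n x))
        where
        -- Pairing is monotone, and strictly so in its second argument, where the stage stands.
        earlier : ∀ {m z} → m ≤ n → z ≤ x → ⟨ ⟨ m , z ⟩ , s ⟩ < u
        earlier {m} {z} m≤n z≤x = subst (⟨ ⟨ m , z ⟩ , s ⟩ <_)
          (trans (cong₂ ⟨_,_⟩ (⟨π₁,π₂⟩ (π₁ u)) (sym eq)) (⟨π₁,π₂⟩ u))
          (⟨,⟩-mono-≤-< (⟨,⟩-mono-≤ m≤n z≤x) (n<1+n s))
        recorded : ∀ m z → m ≤ n → z ≤ x → Recorded u h s m z ⇔ U s m z
        recorded m z m≤n z≤x = subst (λ V → Recorded u h s m z ⇔ V)
          (trans (cong (λ p → U (proj₂ p) (π₁ (proj₁ p)) (π₂ (proj₁ p))) (unpair-⟨,⟩ ⟨ m , z ⟩ s))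
                 (cong (λ p → U s (proj₁ p) (proj₂ p)) (unpair-⟨,⟩ m z)))
          (agree ⟨ ⟨ m , z ⟩ , s ⟩ (earlier m≤n z≤x))

    Codedᴿ : Recursive Coded
    Codedᴿ = course-of-valuesᴿ (λ u h → Body (π₂ u) u h) Bodyᴿ Body-⇔

  Uᴿ : Recursive₃ U
  Uᴿ = Recursive-resp
    (λ w → let n = π₁ (π₂ w) ; x = π₂ (π₂ w) ; s = π₁ w in
       subst (λ V → V ⇔ U s n x)
         (sym (trans (cong (λ p → U (proj₂ p) (π₁ (proj₁ p)) (π₂ (proj₁ p))) (unpair-⟨,⟩ ⟨ n , x ⟩ s))
                     (cong (λ p → U s (proj₁ p) (proj₂ p)) (unpair-⟨,⟩ n x))))
         (mk⇔ (λ p → p) (λ p → p)))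
    (∘ᴿ Codedᴿ (pairᶜ (pairᶜ (fstᶜ new) (sndᶜ new)) out))

-- Tuples indexed by numbers, and the presentation to be found

Descends : ℕ → (ℕ → ℕ) → Set
Descends j e = ∀ i → i < j → W (e (suc i)) ⊆ W (e i)

Φᴺ : Pred ℕ 0ℓ → ℕ → (b d : ℕ → ℕ) → Pred ℕ 0ℓ → Set
Φᴺ A j b d S = ∀ i → i < suc j → W (b i) ∩ (S ∖ A) ≐ W (d i) ∩ (S ∖ A)

Ψᴺ : Pred ℕ 0ℓ → ℕ → (b : ℕ → ℕ) → Pred ℕ 0ℓ → (t : ℕ → ℕ) → Set
Ψᴺ A j b S t =
  (∀ i → i < j → (A ∪ W (t (suc i))) ∩ (S ∩ W (t i)) ≐ W (b i) ∩ (S ∩ W (t i))) ×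
  A ∩ (S ∩ W (t j)) ≐ W (b j) ∩ (S ∩ W (t j))

-- The matrix of QEven, with tuples coded by numbers.
Strategy : ℕ → Pred ℕ 0ℓ → ℕ → Set
Strategy j A c =
  ∀ (b : ℕ → ℕ) → W (b 0) ⊆ W c → Descends j b →
  ∃[ d ] (W (elem d 0) ⊆ W c × Descends j (elem d) ×
  (∀ s → W s ⊏ W c →
  ∃[ t ] (∁ (W c) ⊆ W (elem t 0) × Descends j (elem t) ×
  (Φᴺ A j b (elem d) (W s) → Ψᴺ A j b (W s) (elem t)))))

Descends⇒⊆ : ∀ {j e} → Descends j e → ∀ m {i} → m + i ≤ j → W (e (m + i)) ⊆ W (e i)
Descends⇒⊆ desc zero    p = λ x∈ → x∈
Descends⇒⊆ desc (suc m) p = Descends⇒⊆ desc m (<⇒≤ p) ∘ desc _ p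

Descends⇒⊆′ : ∀ {j e i i′} → Descends j e → i ≤ j → i′ ≤ i → W (e i) ⊆ W (e i′)
Descends⇒⊆′ {j} {e} {i} {i′} desc i≤j i′≤i =
  subst (λ n → n ≤ j → W (e n) ⊆ W (e i′)) (m∸n+n≡m i′≤i) (Descends⇒⊆ desc (i ∸ i′)) i≤j

W[]-mono : ∀ {e s t} → s ≤ t → W[ e , s ] ⊆ W[ e , t ]
W[]-mono s≤t (x<s , y , p) = <-≤-trans x<s s≤t , y , Run-mono s≤t p

-- That the differences avoid `A` follows from the second clause when `α` is monotone and exhausts
-- `A`.
Presented : Pred ℕ 0ℓ → (ℕ → ℕ → Set) → ℕ → Set
Presented A α k = Σ[ g ∈ (ℕ → ℕ) ] Σ[ h ∈ (ℕ → ℕ) ]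
  ((∀ {x} → ¬ A x → ∃[ i ] (i < k × x ∈ W (g i) × x ∉ W (h i))) ×
   (∀ {i s x} → i < k → x ∈ W[ g i , s ] → x ∉ W[ h i , s ] → ¬ α s x))

module Classical (em : ExcludedMiddle 0ℓ) where

  stable : ∀ {P : Set} → ¬ ¬ P → P
  stable = decidable-stable em

  ¬∀⇒∃¬ : ∀ {P : ℕ → Set} → ¬ (∀ x → P x) → ∃[ x ] (¬ P x)
  ¬∀⇒∃¬ ¬all = stable λ none → ¬all λ x → stable λ ¬p → none (x , ¬p)

  minimal : ∀ (P : ℕ → Set) {n} → P n → ∃[ m ] (P m × (∀ i → i < m → ¬ P i))
  minimal P {n} = <-rec _ step n
    where
    step : ∀ n → (∀ {i} → i < n → P i → ∃[ m ] (P m × (∀ i → i < m → ¬ P i))) →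
           P n → ∃[ m ] (P m × (∀ i → i < m → ¬ P i))
    step n ih p with em {∃[ i ] (i < n × P i)}
    ... | yes (i , i<n , q) = ih i<n q
    ... | no none           = n , p , λ i i<n q → none (i , i<n , q)

-- Verification of the construction

module Argument
  (em : ExcludedMiddle 0ℓ) {A : Pred ℕ 0ℓ} (α : ℕ → ℕ → Set) (αᴿ : Recursive₂ α)
  (α-mono : ∀ {s t x} → s ≤ t → α s x → α t x) (A≐⋃α : A ≐ ⋃ ℕ α)
  {c j : ℕ} (A⊂C : A ⊂ₘ W c) (strategy : Strategy j A c) where

  open Classical em
  open Construction α αᴿ c (suc j)

  α⇒A : ∀ {s x} → α s x → A x
  α⇒A p = proj₂ A≐⋃α (_ , p)

  C-mono : ∀ {s t x} → s ≤ t → C s x → C t x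
  C-mono s≤t = [ inj₁ ∘ Seen-mono s≤t , inj₂ ∘ α-mono s≤t ]′

  C⇒W : ∀ {s x} → C s x → x ∈ W c
  C⇒W = [ Seen⇒W , proj₁ A⊂C ∘ α⇒A ]′

  W⇒C : ∀ {x} → x ∈ W c → ∃[ s ] C s x
  W⇒C = map₂ inj₁ ∘ W⇒Seen

  U-mono : ∀ {s t n x} → s ≤ t → U s n x → U t n x
  U-mono {s} {n = n} {x} s≤t p = go (≤⇒≤′ s≤t)
    where
    go : ∀ {t} → s ≤′ t → U t n x
    go ≤′-refl     = p
    go (≤′-step q) = from (U-suc _ n x) (inj₁ (go q))

  U-entered : ∀ s {n x} → U s n x → ∃[ r ] (r < s × ¬ C r x × Long (U r) n r x)
  U-entered zero p = ⊥-elim (¬U-zero p)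
  U-entered (suc s) {n} {x} p with to (U-suc s n x) p
  ... | inj₁ q with r , r<s , entered ← U-entered s q = r , m≤n⇒m≤1+n r<s , entered
  ... | inj₂ q = s , ≤-refl , q

  -- Numbers are promised only while outside `C`, so the allotment of `x` can be read off at any
  -- stage that finds `x` in `C`.
  U-frozen : ∀ s {r n x} → C r x → U s n x → U r n x
  U-frozen zero Cx p = ⊥-elim (¬U-zero p)
  U-frozen (suc s) {r} {n} {x} Cx p with to (U-suc s n x) p
  ... | inj₁ q = U-frozen s Cx q
  ... | inj₂ (¬C , _) with r ≤? s
  ...   | yes r≤s = ⊥-elim (¬C (C-mono r≤s Cx))
  ...   | no r≰s  = U-mono (≰⇒> r≰s) p

  U-bound : ∀ {s n x} → U s n x → n < s
  U-bound {s} {n} {x} p with r , r<s , _ , n+x≤r , _ ← U-entered s p =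
    ≤-<-trans (≤-trans (m≤m+n n x) n+x≤r) r<s

  Least-frozen : ∀ {r s n x} → C r x → C s x → Least (U r) n x → Least (U s) n x
  Least-frozen {r} {s} Cr Cs (p , least) = U-frozen r Cs p , λ m m<n q → least m m<n (U-frozen s Cr q)

  Least-unique : ∀ {r s m n x} → C r x → C s x → Least (U r) m x → Least (U s) n x → m ≡ n
  Least-unique {m = m} {n} Cr Cs p q with <-cmp m n
  ... | tri≈ _ m≡n _ = m≡n
  ... | tri< m<n _ _ = ⊥-elim (proj₂ q m m<n (proj₁ (Least-frozen Cr Cs p)))
  ... | tri> _ _ n<m = ⊥-elim (proj₂ p n n<m (proj₁ (Least-frozen Cs Cr q)))

  Expanding : ℕ → Set
  Expanding n = ∀ x → ∃[ s ] Long (U s) n s x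

  private
    out : Computable π₁
    out = fstᶜ idᶜ
    new : Computable π₂
    new = sndᶜ idᶜ

  -- Asking for every `i′` up to `i` makes the sets descend whatever is guessed; `¬ α s x` is what
  -- later yields `Late`.
  B : ℕ → ℕ → ℕ → Set
  B i x s = C s x × ∃[ m ] (Least (U s) m x × ¬ α s x × (∀ i′ → i′ < suc i → Seen (δ m i′) s x))

  Bᴿ : ∀ i → Recursive₂ (B i)
  Bᴿ i = ×ᴿ (app₂ᴿ C Cᴿ new out)
    (∃ᴿ (λ z m → Least (U (π₂ z)) m (π₁ z) × ¬ α (π₂ z) (π₁ z) × (∀ i′ → i′ < suc i → Seen (δ m i′) (π₂ z) (π₁ z)))
      (×ᴿ (app₃ᴿ (λ s → Least (U s)) (Leastᴿ U Uᴿ) (sndᶜ out) new (fstᶜ out))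
      (×ᴿ (¬ᴿ (app₂ᴿ α αᴿ (sndᶜ out) (fstᶜ out)))
          (∀<ᴿ (λ w i′ → Seen (δ (π₂ w) i′) (π₂ (π₁ w)) (π₁ (π₁ w)))
            (app₃ᴿ Seen Seenᴿ (app₂ elem elemᶜ (fstᶜ (sndᶜ out)) new) (sndᶜ (fstᶜ out)) (fstᶜ (fstᶜ out)))
            (constᶜ (suc i)))))
      new (λ {z} {m} p → U-bound {π₂ z} {m} {π₁ z} (proj₁ (proj₁ p))))

  -- Only the D's are fixed: `Strategy` supplies the T's after `S`, so `S` cannot depend on them.
  Allotted : ℕ → ℕ → ℕ → Set
  Allotted d x s = ∃[ m ] (Least (U s) m x × π₁ m ≡ d)

  Allottedᴿ : ∀ d → Recursive₂ (Allotted d)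
  Allottedᴿ d = ∃ᴿ (λ z m → Least (U (π₂ z)) m (π₁ z) × π₁ m ≡ d)
    (×ᴿ (app₃ᴿ (λ s → Least (U s)) (Leastᴿ U Uᴿ) (sndᶜ out) new (fstᶜ out)) (≡ᴿ (fstᶜ new) (constᶜ d)))
    new (λ {z} {m} p → U-bound {π₂ z} {m} {π₁ z} (proj₁ (proj₁ p)))

  opaque
    b : ℕ → ℕ
    b i = proj₁ (enumeration (B i) (Bᴿ i))

    B⇒W : ∀ i {x s} → B i x s → x ∈ W (b i)
    B⇒W i = proj₁ (proj₂ (enumeration (B i) (Bᴿ i)))

    W⇒B : ∀ i {x} → x ∈ W (b i) → ∃[ s ] B i x s
    W⇒B i (s , p) = map₂ proj₂ (proj₂ (proj₂ (enumeration (B i) (Bᴿ i))) p)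

  b-⊆ : ∀ i → W (b i) ⊆ W c
  b-⊆ i p = C⇒W (proj₁ (proj₂ (W⇒B i p)))

  B-descends : ∀ i {x s} → B (suc i) x s → B i x s
  B-descends i (Cx , m , least , ¬a , seen) = Cx , m , least , ¬a , λ i′ i′≤i → seen i′ (m≤n⇒m≤1+n i′≤i)

  b-descends : Descends j b
  b-descends i _ {x} p with s , q ← W⇒B (suc i) {x} p = B⇒W i {x} {s} (B-descends i {x} {s} q)

  -- Once `x` is in `C` the truth of `R x` no longer changes, so it is decided on entry and both
  -- halves of `C` are c.e.
  splitting : ∀ (R : ℕ → ℕ → Set) → Recursive₂ R → (∀ {x s t} → C s x → C t x → R x s → R x t) →
    ∃[ e ] (W e ⊏ W c × (∀ {x} → x ∈ W e → ∃[ s ] (C s x × R x s)) × (∀ {x s} → C s x → R x s → x ∈ W e))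
  splitting R r frozen
    with e , e⇐ , e⇒ ← enumeration (λ x s → C s x × R x s) (×ᴿ (app₂ᴿ C Cᴿ new out) r)
    with e′ , e′⇐ , e′⇒ ← enumeration (λ x s → C s x × ¬ R x s) (×ᴿ (app₂ᴿ C Cᴿ new out) (¬ᴿ r))
    = e , (e′ , (⊆C , C⊆) , disjoint) , (λ (_ , p) → map₂ proj₂ (e⇒ p)) , λ Cx p → e⇐ (Cx , p)
    where
    ⊆C : W e ∪ W e′ ⊆ W c
    ⊆C (inj₁ (_ , p)) = C⇒W (proj₁ (proj₂ (proj₂ (e⇒ p))))
    ⊆C (inj₂ (_ , p)) = C⇒W (proj₁ (proj₂ (proj₂ (e′⇒ p))))
    C⊆ : W c ⊆ W e ∪ W e′
    C⊆ {x} p with s , Cx ← W⇒C p with em {R x s}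
    ... | yes q = inj₁ (e⇐ (Cx , q))
    ... | no ¬q = inj₂ (e′⇐ (Cx , ¬q))
    disjoint : ∀ {x} → ¬ (x ∈ W e × x ∈ W e′)
    disjoint ((_ , p) , (_ , p′))
      with _ , _ , Cx , q ← e⇒ p | _ , _ , Cx′ , ¬q ← e′⇒ p′ = ¬q (frozen Cx Cx′ q)

  Allotted-frozen : ∀ d {x s t} → C s x → C t x → Allotted d x s → Allotted d x t
  Allotted-frozen d Cs Ct (m , least , eq) = m , Least-frozen Cs Ct least , eq

  -- Membership in `W (b i)` records a stage at which `x` was in `δ n i` but not in `α`; any stage
  -- with `x` in `α` comes later. The recorded guess is `n`, as allotments never change.
  late-agrees : ∀ {n s x} → C s x → Least (U s) n x →
                (∀ i → i < suc j → x ∈ W (τ n i) → A x → x ∈ W (b i)) → ∀ r → Late n r x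
  late-agrees {n} {x = x} Cx least agree r i i<k t a
    with s , Cx′ , m , least′ , ¬a , seen ← W⇒B i (agree i i<k (Seen⇒W t) (α⇒A a))
    with refl ← Least-unique Cx Cx′ least least′
    = Seen-mono (≰⇒≥ λ r≤s → ¬a (α-mono r≤s a)) (seen i ≤-refl)

  covered-eventually : ∀ {n x} → A x ⊎ ∃[ i ] (i < suc j × x ∈ W (τ n i) × x ∉ W (δ n i)) →
                       ∃[ s ] (∀ t → s ≤ t → Covered n t x)
  covered-eventually (inj₁ a) with s , p ← proj₁ A≐⋃α a = s , λ t s≤t → inj₁ (α-mono s≤t p)
  covered-eventually (inj₂ (i , i<k , x∈ , x∉)) with s , p ← W⇒Seen x∈ =
    s , λ t s≤t → inj₂ (i , i<k , Seen-mono s≤t p , x∉ ∘ Seen⇒W)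

  module _ (n : ℕ) (δ-⊆ : W (δ n 0) ⊆ W c) (δ-descends : Descends j (δ n))
    (e : ℕ) (e⇒ : ∀ {x} → x ∈ W e → ∃[ s ] (C s x × Allotted (π₁ n) x s))
    (e⇐ : ∀ {x s} → C s x → Allotted (π₁ n) x s → x ∈ W e)
    (τ-⊇ : ∁ (W c) ⊆ W (τ n 0)) (τ-descends : Descends j (τ n))
    (Φ⇒Ψ : Φᴺ A j b (δ n) (W e) → Ψᴺ A j b (W e) (τ n)) where

    private
      -- Numbers in `W e` are allotted to guesses with the same D's as `n`, and outside `A` the
      -- clause `¬ α s x` holds at every stage.
      φ : Φᴺ A j b (δ n) (W e)
      φ i (s≤s i≤j) = sound , complete
        where
        sound : W (b i) ∩ (W e ∖ A) ⊆ W (δ n i) ∩ (W e ∖ A)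
        sound (x∈b , x∈e , x∉A)
          with _ , Cx , m , least , _ , seen ← W⇒B i x∈b | _ , Cx′ , m′ , least′ , eq ← e⇒ x∈e
          with refl ← Least-unique Cx Cx′ least least′
          = subst (λ d → _ ∈ W (elem d i)) eq (Seen⇒W (seen i ≤-refl)) , x∈e , x∉A
        complete : W (δ n i) ∩ (W e ∖ A) ⊆ W (b i) ∩ (W e ∖ A)
        complete {x} (x∈δ , x∈e , x∉A)
          with s , Cx , m , least , eq ← e⇒ x∈e
          -- `B i` asks for the preceding D's as well; descent supplies them.
          with t , seen ← uniform-bound {λ i′ t → Seen (δ n i′) t x} Seen-mono (suc i)
                 (λ i′ i′≤i → W⇒Seen (Descends⇒⊆′ δ-descends i≤j (s≤s⁻¹ i′≤i) x∈δ))
          = B⇒W i (C-mono (m≤m⊔n s t) Cx , m , Least-frozen Cx (C-mono (m≤m⊔n s t) Cx) least , x∉A ∘ α⇒A ,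
                   λ i′ i′≤i → subst (λ d → Seen (elem d i′) (s ⊔ t) x) (sym eq) (Seen-mono (m≤n⊔m s t) (seen i′ i′≤i))) ,
            x∈e , x∉A

      ψ : Ψᴺ A j b (W e) (τ n)
      ψ = Φ⇒Ψ φ

      A⇒b : ∀ {x} → x ∈ W e → ∀ i → i < suc j → x ∈ W (τ n i) → A x → x ∈ W (b i)
      A⇒b x∈e i i<k x∈τ a with m<1+n⇒m<n∨m≡n i<k
      ... | inj₁ i<j  = proj₁ (proj₁ (proj₁ ψ i i<j) (inj₁ a , x∈e , x∈τ))
      ... | inj₂ refl = proj₁ (proj₁ (proj₂ ψ) (a , x∈e , x∈τ))

      -- Otherwise `x` climbs through the T's: from Tᵢ into Dᵢ for want of separation, into Bᵢ by Φ,
      -- and into A ∪ Tᵢ₊₁ by Ψ. The last clause of Ψ then puts it into `A`.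
      separated : ∀ {x} → x ∈ W e → x ∈ W (τ n 0) → ¬ A x → ∃[ i ] (i < suc j × x ∈ W (τ n i) × x ∉ W (δ n i))
      separated {x} x∈e x∈τ₀ x∉A = stable λ none → x∉A (last none)
        where
        module _ (none : ¬ (∃[ i ] (i < suc j × x ∈ W (τ n i) × x ∉ W (δ n i)))) where
          step : ∀ i → i < suc j → x ∈ W (τ n i) → x ∈ W (b i)
          step i i<k x∈τ = proj₁ (proj₂ (φ i i<k) (stable (λ x∉δ → none (i , i<k , x∈τ , x∉δ)) , x∈e , x∉A))
          all : ∀ i → i < suc j → x ∈ W (τ n i)
          all zero    _ = x∈τ₀
          all (suc i) (s≤s i<j) with all i (m≤n⇒m≤1+n i<j)
          ... | x∈τ = [ ⊥-elim ∘ x∉A , (λ p → p) ]′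
            (proj₁ (proj₂ (proj₁ ψ i i<j) (step i (m≤n⇒m≤1+n i<j) x∈τ , x∈e , x∈τ)))
          last : A x
          last = proj₁ (proj₂ (proj₂ ψ) (step j ≤-refl (all j ≤-refl) , x∈e , all j ≤-refl))

    -- Outside `C` the first pair separates, as T₁ ⊇ ∁ C and D₁ ⊆ C. In `C`, `x` is either not
    -- allotted to `n`, and then excused, or in `W e`, where Φ and Ψ apply.
    ok-eventually : ∀ x → ∃[ s ] (∀ t → s ≤ t → Ok (U t) n t x)
    ok-eventually x with em {x ∈ W c}
    ... | no x∉c with s , covered ← covered-eventually {n} {x} (inj₂ (0 , s≤s z≤n , τ-⊇ x∉c , x∉c ∘ δ-⊆))
      = s , λ t s≤t → inj₂ ((λ r _ i _ _ a → ⊥-elim (x∉c (proj₁ A⊂C (α⇒A a)))) , covered t s≤t)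
    ... | yes x∈c with s , Cx ← W⇒C x∈c with em {Least (U s) n x}
    ...   | no ¬least = s , λ t s≤t → inj₁ (C-mono s≤t Cx , λ least → ¬least (Least-frozen (C-mono s≤t Cx) Cx least))
    ...   | yes least = map₂ (λ covered t s≤t → inj₂ ((λ r _ → late-agrees Cx least (A⇒b x∈e) r) , covered t s≤t))
                             (covered-eventually {n} {x} covered′)
      where
      x∈e : x ∈ W e
      x∈e = e⇐ Cx (n , least , refl)
      covered-at-entry : ∀ {r} → ¬ C r x → Ok (U r) n r x → x ∈ W (τ n 0)
      covered-at-entry ¬C (inj₁ (Cx , _)) = ⊥-elim (¬C Cx)
      covered-at-entry ¬C (inj₂ (_ , inj₁ a)) = ⊥-elim (¬C (inj₂ a))
      covered-at-entry ¬C (inj₂ (_ , inj₂ (i , s≤s i≤j , t , _))) = Descends⇒⊆′ τ-descends i≤j z≤n (Seen⇒W t)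
      x∈τ₀ : x ∈ W (τ n 0)
      -- When promised, `x` was covered but not in `C`, hence not in `α`; so it was in some Tᵢ, and
      -- Tᵢ ⊆ T₁.
      x∈τ₀ with r , _ , ¬C , _ , ok ← U-entered s (proj₁ least) = covered-at-entry ¬C (ok x ≤-refl)
      covered′ : A x ⊎ ∃[ i ] (i < suc j × x ∈ W (τ n i) × x ∉ W (δ n i))
      covered′ with em {A x}
      ... | yes a = inj₁ a
      ... | no ¬a = inj₂ (separated x∈e x∈τ₀ ¬a)

    expanding : Expanding n
    expanding x with s , ok ← uniform-bound {λ z s → ∀ t → s ≤ t → Ok (U t) n t z}
                                (λ s≤t p u t≤u → p u (≤-trans s≤t t≤u)) (suc x) (λ z _ → ok-eventually z)
      = s ⊔ (n + x) , m≤n⊔m s (n + x) , λ z z≤x → ok z z≤x _ (m≤m⊔n s (n + x))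

  expanding-exists : ∃[ n ] Expanding n
  expanding-exists = against (strategy b (b-⊆ 0) b-descends)
    where
    expands : ∀ n {d t} → π₁ n ≡ d → π₂ n ≡ t → W (elem d 0) ⊆ W c → Descends j (elem d) → ∀ e →
              (∀ {x} → x ∈ W e → ∃[ s ] (C s x × Allotted d x s)) → (∀ {x s} → C s x → Allotted d x s → x ∈ W e) →
              ∁ (W c) ⊆ W (elem t 0) → Descends j (elem t) →
              (Φᴺ A j b (elem d) (W e) → Ψᴺ A j b (W e) (elem t)) → Expanding n
    expands n refl refl = expanding n
    against : ∃[ d ] (W (elem d 0) ⊆ W c × Descends j (elem d) ×
                (∀ s → W s ⊏ W c → ∃[ t ] (∁ (W c) ⊆ W (elem t 0) × Descends j (elem t) ×
                (Φᴺ A j b (elem d) (W s) → Ψᴺ A j b (W s) (elem t))))) → ∃[ n ] Expanding n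
    against (d , δ-⊆ , δ-descends , respond) = versus (splitting (Allotted d) (Allottedᴿ d) (Allotted-frozen d))
      where
      versus : ∃[ e ] (W e ⊏ W c × (∀ {x} → x ∈ W e → ∃[ s ] (C s x × Allotted d x s)) ×
                       (∀ {x s} → C s x → Allotted d x s → x ∈ W e)) → ∃[ n ] Expanding n
      versus (e , split , e⇒ , e⇐) with t , τ-⊇ , τ-descends , Φ⇒Ψ ← respond e split
        = ⟨ d , t ⟩ , expands ⟨ d , t ⟩ (π₁-⟨,⟩ d t) (π₂-⟨,⟩ d t) δ-⊆ δ-descends e e⇒ e⇐ τ-⊇ τ-descends Φ⇒Ψ

  -- A promise of `x` requires `Ok` at all numbers up to `x`, hence up to any `M ≤ x`.
  U-finite : ∀ {m} → ¬ Expanding m → ∃[ M ] (∀ {x s} → M ≤ x → ¬ U s m x)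
  U-finite {m} ¬expanding with M , ¬long ← ¬∀⇒∃¬ {λ x → ∃[ s ] Long (U s) m s x} ¬expanding = M , finite
    where
    finite : ∀ {x s} → M ≤ x → ¬ U s m x
    finite {x} {s} M≤x p with r , _ , _ , m+x≤r , ok ← U-entered s p =
      ¬long (r , ≤-trans (+-monoʳ-≤ m M≤x) m+x≤r , λ z z≤M → ok z (≤-trans z≤M (s≤s M≤x)))

  -- Below M, the set ∁ A is added to every W (gᵉ i), and W (hᵉ i) is emptied.
  module _ {n M : ℕ} (grows : Expanding n) (finite : ∀ m → m < n → ∀ {x s} → M ≤ x → ¬ U s m x)
           (cover : ∀ {x} → M ≤ x → ¬ A x → ∃[ s ] U s n x) where

    -- Once `x` is promised, `n` is the least guess with a claim to it, so `Ok` cannot be due to the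
    -- excuse.
    good-often : ∀ {s₀ x} → M ≤ x → U s₀ n x → ∀ s₁ → ∃[ s ] (s₁ ≤ s × Good n s x)
    -- Being long this far forces the stage past both `s₁` and the promise.
    good-often {s₀} {x} M≤x u s₁ with s , n+y≤s , ok ← grows (x ⊔ (s₁ ⊔ s₀)) =
      s , ≤-trans (m≤m⊔n s₁ s₀) s₁⊔s₀≤s , [ (λ (_ , ¬least) → ⊥-elim (¬least least)) , (λ good → good) ]′
                                             (ok x (s≤s (m≤m⊔n x (s₁ ⊔ s₀))))
      where
      s₁⊔s₀≤s : s₁ ⊔ s₀ ≤ s
      s₁⊔s₀≤s = ≤-trans (m≤n⊔m x (s₁ ⊔ s₀)) (≤-trans (m≤n+m _ n) n+y≤s)
      least : Least (U s) n x
      least = U-mono (≤-trans (m≤n⊔m s₁ s₀) s₁⊔s₀≤s) u , λ m m<n → finite m m<n M≤x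

    -- A good stage vouches for all stages before it, and good stages are unbounded.
    late : ∀ {s₀ x} → M ≤ x → U s₀ n x → ∀ s → Late n s x
    late M≤x u s with t , s≤t , lates , _ ← good-often M≤x u s = lates s (s≤s s≤t)

    -- From `M` on, `x` is held back until it is promised, because `late` needs a promise; by
    -- `cover` no element of ∁ A is lost.
    G : ℕ → ℕ → ℕ → Set
    G i x s = (x < M × ¬ A x) ⊎ (M ≤ x × U s n x × Seen (τ n i) s x)

    Gᴿ : ∀ i → Recursive₂ (G i)
    Gᴿ i = ⊎ᴿ (∘ᴿ (finiteᴿ (λ x → em {¬ A x}) M) out)
      (×ᴿ (≤ᴿ (constᶜ M) out)
      (×ᴿ (app₃ᴿ U Uᴿ new (constᶜ n) out) (app₃ᴿ Seen Seenᴿ (constᶜ (τ n i)) new out)))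

    opaque
      gᵉ : ℕ → ℕ
      gᵉ i = proj₁ (enumeration (G i) (Gᴿ i))

      G⇒W : ∀ i {x s} → G i x s → x ∈ W (gᵉ i)
      G⇒W i = proj₁ (proj₂ (enumeration (G i) (Gᴿ i)))

      W[]⇒G : ∀ i {x s} → x ∈ W[ gᵉ i , s ] → ∃[ r ] (r ≤ s × G i x r)
      W[]⇒G i = proj₂ (proj₂ (enumeration (G i) (Gᴿ i)))

    hᵉ : ℕ → ℕ
    hᵉ i = restrict M (δ n i)

    -- A promised number seen in `τ n i` and lying in `α` has by then been seen in `δ n i`, and
    -- `Seen` is slow enough for `W[ hᵉ i , s ]` to contain it.
    tardy : ∀ {i s x} → i < suc j → x ∈ W[ gᵉ i , s ] → x ∉ W[ hᵉ i , s ] → ¬ α s x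
    tardy {i} {s} {x} i<k x∈g x∉h a with W[]⇒G i x∈g
    ... | r , r≤s , inj₁ (_ , ¬a) = ¬a (α⇒A a)
    ... | r , r≤s , inj₂ (M≤x , u , t) = x∉h (Seen⇒W[] M≤x (late M≤x u s i i<k (Seen-mono r≤s t) a))

    settled : ∀ x → ∃[ s ] (∀ i → i < suc j → x ∈ W (δ n i) → Seen (δ n i) s x)
    settled x = uniform-bound {λ i s → x ∈ W (δ n i) → Seen (δ n i) s x} (λ s≤t p → Seen-mono s≤t ∘ p) (suc j) settles
      where
      settles : ∀ i → i < suc j → ∃[ s ] (x ∈ W (δ n i) → Seen (δ n i) s x)
      settles i _ with em {x ∈ W (δ n i)}
      ... | yes p = map₂ (λ q _ → q) (W⇒Seen p)
      ... | no ¬p = 0 , ⊥-elim ∘ ¬p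

    -- At a good stage past `settled`, what is not yet seen in a D never enters it.
    covered : ∀ {s₀ x} → M ≤ x → U s₀ n x → ¬ A x → ∃[ i ] (i < suc j × x ∈ W (gᵉ i) × x ∉ W (hᵉ i))
    covered {s₀} {x} M≤x u ¬a
      with s₁ , settled ← settled x
      with s , s₁≤s , _ , c ← good-often M≤x u s₁
      = separates c
      where
      separates : Covered n s x → ∃[ i ] (i < suc j × x ∈ W (gᵉ i) × x ∉ W (hᵉ i))
      separates (inj₁ a) = ⊥-elim (¬a (α⇒A a))
      separates (inj₂ (i , i<k , t , ¬d)) = i , i<k ,
        G⇒W i {x} {s₀ ⊔ s} (inj₂ (M≤x , U-mono (m≤m⊔n s₀ s) u , Seen-mono (m≤n⊔m s₀ s) t)) ,
        λ x∈h → ¬d (Seen-mono s₁≤s (settled i i<k (proj₂ (restrict-W⇒ {M} {δ n i} x∈h))))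

    complement : ∀ {x} → ¬ A x → ∃[ i ] (i < suc j × x ∈ W (gᵉ i) × x ∉ W (hᵉ i))
    complement {x} ¬a with x <? M
    ... | yes x<M = 0 , s≤s z≤n , G⇒W 0 {x} {0} (inj₁ (x<M , ¬a)) ,
                    λ x∈h → <⇒≱ x<M (proj₁ (restrict-W⇒ {M} {δ n 0} x∈h))
    ... | no x≮M with s , u ← cover (≮⇒≥ x≮M) ¬a = covered (≮⇒≥ x≮M) u ¬a

    presented-by : Presented A α (suc j)
    presented-by = gᵉ , hᵉ , complement , tardy

  presented : Presented A α (suc j)
  presented = from-least (minimal Expanding (proj₂ expanding-exists))
    where
    from-least : ∃[ n ] (Expanding n × (∀ m → m < n → ¬ Expanding m)) → Presented A α (suc j)
    from-least (n , grows , shrinks)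
      with M₁ , finite ← uniform-bound {λ m M → ∀ {x s} → M ≤ x → ¬ U s m x} (λ M≤N p N≤x → p (≤-trans M≤N N≤x)) n
                           (λ m m<n → U-finite (shrinks m m<n))
      = above (enumeration (λ x s → U s n x) (app₃ᴿ U Uᴿ new (constᶜ n) out))
      where
      above : ∃[ e ] ((∀ {x s} → U s n x → x ∈ W e) ×
                      (∀ {s x} → x ∈ W[ e , s ] → ∃[ r ] (r ≤ s × U r n x))) → Presented A α (suc j)
      above (e , U⇒W , W⇒U) =
        presented-by {n} {M₁ ⊔ M₂} grows (λ m m<n M≤x → finite m m<n (≤-trans (m≤m⊔n M₁ M₂) M≤x)) cover
        where
        ∁C⊆ : ∁ (W c) ⊆ W e
        -- Outside `C` nothing bars a promise, so the stage that is long up to `x` makes it.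
        ∁C⊆ {x} x∉c with s , long ← grows x = U⇒W (from (U-suc s n x) (inj₂ (x∉c ∘ C⇒W , long)))
        almost : ∁ A ⊆* W e
        almost = proj₂ (proj₂ A⊂C) e ∁C⊆
        M₂ : ℕ
        M₂ = proj₁ almost
        cover : ∀ {x} → M₁ ⊔ M₂ ≤ x → ¬ A x → ∃[ s ] U s n x
        cover {x} M≤x ¬a with _ , p ← stable (λ x∉e → proj₂ almost x (≤-trans (m≤n⊔m M₁ M₂) M≤x) (¬a , x∉e))
          = map₂ proj₂ (W⇒U p)

-- From vectors of indices to coded sequences

code : ∀ {k} → Vector ℕ k → ℕ
code {zero}  v = 0
code {suc k} v = ⟨ v zero , code (v ∘ suc) ⟩

drop-⟨,⟩ : ∀ a h n → drop ⟨ a , h ⟩ (suc n) ≡ drop h n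
drop-⟨,⟩ a h zero    = π₂-⟨,⟩ a h
drop-⟨,⟩ a h (suc n) = cong π₂ (drop-⟨,⟩ a h n)

elem-code : ∀ {k} (v : Vector ℕ k) i → elem (code v) (toℕ i) ≡ v i
elem-code v zero    = π₁-⟨,⟩ (v zero) (code (v ∘ suc))
elem-code v (suc i) = trans (cong π₁ (drop-⟨,⟩ (v zero) _ (toℕ i))) (elem-code (v ∘ suc) i)

elem-inject₁ : ∀ {k} (v : Vector ℕ (suc k)) i → elem (code v) (toℕ i) ≡ v (inject₁ i)
elem-inject₁ v i = trans (cong (elem (code v)) (sym (toℕ-inject₁ i))) (elem-code v (inject₁ i))

elem-fromℕ : ∀ {k} (v : Vector ℕ (suc k)) → elem (code v) k ≡ v (fromℕ k)
elem-fromℕ {k} v = trans (cong (elem (code v)) (sym (toℕ-fromℕ k))) (elem-code v (fromℕ k))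

∀Fin⇒∀< : ∀ {k} (P : ℕ → Set) → (∀ (i : Fin k) → P (toℕ i)) → ∀ i → i < k → P i
∀Fin⇒∀< P p i i<k = subst P (toℕ-fromℕ< i<k) (p (fromℕ< i<k))

Descending⇒Descends : ∀ {j} (v : Vector ℕ (suc j)) → Descending v → Descends j (elem (code v))
Descending⇒Descends v desc = ∀Fin⇒∀< (λ i → W (elem (code v) (suc i)) ⊆ W (elem (code v) i))
  λ i → subst₂ (λ a b → W a ⊆ W b) (sym (elem-code v (suc i))) (sym (elem-inject₁ v i)) (desc i)

QEven⇒Strategy : ∀ {j A} → QEven j A → ∃[ c ] (A ⊂ₘ W c × Strategy j A c)
QEven⇒Strategy {j} {A} (c , A⊂C , q) = c , A⊂C , strategy
  where
  strategy : Strategy j A c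
  strategy b b⊆C descends with d , d⊆C , d-descending , respond ← q (b ∘ toℕ) b⊆C
      (λ i → subst (λ n → W (b (suc (toℕ i))) ⊆ W (b n)) (sym (toℕ-inject₁ i)) (descends (toℕ i) (toℕ<n i)))
    = code d , subst (λ e → W e ⊆ W c) (sym (elem-code d zero)) d⊆C , Descending⇒Descends d d-descending , reply
    where
    reply : ∀ s → W s ⊏ W c → ∃[ t ] (∁ (W c) ⊆ W (elem t 0) × Descends j (elem t) ×
              (Φᴺ A j b (elem (code d)) (W s) → Ψᴺ A j b (W s) (elem t)))
    reply s split with t , t⊇ , t-descending , Φ⇒Ψ ← respond s split
      = code t , subst (λ e → ∁ (W c) ⊆ W e) (sym (elem-code t zero)) t⊇ , Descending⇒Descends t t-descending ,
        λ φ → ψ (Φ⇒Ψ λ i → subst (λ e → W (b (toℕ i)) ∩ (W s ∖ A) ≐ W e ∩ (W s ∖ A))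
                                 (elem-code d i) (φ (toℕ i) (toℕ<n i)))
      where
      ψ : Ψ A (b ∘ toℕ) (W s) t → Ψᴺ A j b (W s) (elem (code t))
      ψ (between , last) =
        ∀Fin⇒∀< (λ i → (A ∪ W (elem (code t) (suc i))) ∩ (W s ∩ W (elem (code t) i)) ≐
                      W (b i) ∩ (W s ∩ W (elem (code t) i)))
          (λ i → subst₂ (λ e e′ → (A ∪ W e) ∩ (W s ∩ W e′) ≐ W (b (toℕ i)) ∩ (W s ∩ W e′))
                   (sym (elem-code t (suc i))) (sym (elem-inject₁ t i))
                   (subst (λ n → (A ∪ W (t (suc i))) ∩ (W s ∩ W (t (inject₁ i))) ≐ W (b n) ∩ (W s ∩ W (t (inject₁ i))))
                          (toℕ-inject₁ i) (between i))) ,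
        subst₂ (λ n e → A ∩ (W s ∩ W e) ≐ W (b n) ∩ (W s ∩ W e)) (toℕ-fromℕ j) (sym (elem-fromℕ t)) last

-- Computable enumerations

-- `Canonical` halves before recursing; halving afterwards has the form of a primitive recursion.
shift : ℕ → ℕ → ℕ
shift y zero    = y
shift y (suc x) = ⌊ shift y x /2⌋

shiftᶜ : Computable₂ shift
shiftᶜ = primrecᶜ shift (λ _ _ → ⌊_/2⌋) idᶜ (compᶜ ⌊/2⌋ᶜ (sndᶜ (sndᶜ idᶜ))) (λ _ → refl) (λ _ _ → refl)

shift-⌊/2⌋ : ∀ y x → shift ⌊ y /2⌋ x ≡ shift y (suc x)
shift-⌊/2⌋ y zero    = refl
shift-⌊/2⌋ y (suc x) = cong ⌊_/2⌋ (shift-⌊/2⌋ y x)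

shift-Canonical : ∀ y x → (shift y x % 2 ≡ 1) ⇔ Canonical y x
shift-Canonical y zero    = mk⇔ (λ p → p) (λ p → p)
shift-Canonical y (suc x) = subst (λ v → (v % 2 ≡ 1) ⇔ Canonical ⌊ y /2⌋ x) (shift-⌊/2⌋ y x) (shift-Canonical ⌊ y /2⌋ x)

Canonicalᴿ : Recursive₂ Canonical
Canonicalᴿ = Recursive-resp (λ z → shift-Canonical (π₁ z) (π₂ z)) (≡ᴿ (compᶜ %2ᶜ shiftᶜ) (constᶜ 1))

module _ {A : Pred ℕ 0ℓ} (𝓐 : Enumeration A) where

  stage-mono : ∀ {s t} → s ≤ t → stage 𝓐 s ⊆ stage 𝓐 t
  stage-mono {s} s≤t {x} p = go (≤⇒≤′ s≤t)
    where
    go : ∀ {t} → s ≤′ t → stage 𝓐 t x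
    go ≤′-refl     = p
    go (≤′-step {n = t} q) = increasing 𝓐 t {x} (go q)

  -- Adding s makes the stages p s + s unbounded.
  module _ {p : ℕ → ℕ} (p-mono : p Preserves _≤_ ⟶ _≤_) (pᶜ : Computable p) where

    opaque
      delayed : ℕ → ℕ → Set
      delayed s = stage 𝓐 (p s + s)

      delayedᴿ : Recursive₂ delayed
      delayedᴿ = app₂ᴿ Canonical Canonicalᴿ
        (compᶜ (computable 𝓐) (app₂ _+_ +ᶜ (compᶜ pᶜ (fstᶜ idᶜ)) (fstᶜ idᶜ))) (sndᶜ idᶜ)

      delayed-mono : ∀ {s t x} → s ≤ t → delayed s x → delayed t x
      delayed-mono {x = x} s≤t = stage-mono (+-mono-≤ (p-mono s≤t) s≤t) {x}

      A≐⋃delayed : A ≐ ⋃ ℕ delayed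
      A≐⋃delayed = (λ {x} a → map₂ (λ {s} → stage-mono (m≤n+m s (p s)) {x}) (proj₁ (exhaustive 𝓐) a)) ,
                   λ (s , q) → proj₂ (exhaustive 𝓐) (p s + s , q)

      stage⊆delayed : ∀ s → stage 𝓐 (p s) ⊆ delayed s
      stage⊆delayed s {x} = stage-mono (m≤m+n (p s) s) {x}

-- Presentations of n-c.e. sets

-- The end `es` will be empty for even n, and consist of the index of Y for odd n.
interleave : ∀ m {l} → (g h : ℕ → ℕ) → Vec ℕ l → Vec ℕ (m * 2 + l)
interleave zero    g h es = es
interleave (suc m) g h es = g 0 ∷ h 0 ∷ interleave m (g ∘ suc) (h ∘ suc) es

module _ {l} (V : ℕ → Pred ℕ 0ℓ) {es : Vec ℕ l} {x : ℕ} where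

  differences-⇒ : ∀ m {g h} → x ∈ differences (map V (interleave m g h es)) →
                  ∃[ i ] (i < m × x ∈ V (g i) × x ∉ V (h i)) ⊎ x ∈ differences (map V es)
  differences-⇒ zero    p        = inj₂ p
  differences-⇒ (suc m) (inj₁ p) = inj₁ (0 , s≤s z≤n , p)
  differences-⇒ (suc m) (inj₂ p) with differences-⇒ m p
  ... | inj₁ (i , i<m , q) = inj₁ (suc i , s≤s i<m , q)
  ... | inj₂ q             = inj₂ q

  differences-⇐ : ∀ m {g h} → ∃[ i ] (i < m × x ∈ V (g i) × x ∉ V (h i)) ⊎ x ∈ differences (map V es) →
                  x ∈ differences (map V (interleave m g h es))
  differences-⇐ zero    (inj₂ p)                     = p
  differences-⇐ (suc m) (inj₁ (zero , _ , p))        = inj₁ p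
  differences-⇐ (suc m) (inj₁ (suc i , s≤s i<m , p)) = inj₂ (differences-⇐ m (inj₁ (i , i<m , p)))
  differences-⇐ (suc m) (inj₂ p)                     = inj₂ (differences-⇐ m (inj₂ p))

tuple-surjective : ∀ {n} (v : Vec ℕ (suc n)) → ∃[ e ] tuple (suc n) e ≡ v
tuple-surjective (a ∷ [])    = a , refl
tuple-surjective (a ∷ b ∷ v) with e , eq ← tuple-surjective (b ∷ v) =
  ⟨ a , e ⟩ , cong₂ _∷_ (π₁-⟨,⟩ a e) (trans (cong (tuple _) (π₂-⟨,⟩ a e)) eq)

-- `A′` may be larger than `A`; by `rest`, the sets in `es` supply the part of ∁ A that ∁ A′ misses.
Presented⇒n-ce : ∀ {A A′ : Pred ℕ 0ℓ} {α j l} → Presented A′ α (suc j) → (∀ {s t x} → s ≤ t → α s x → α t x) →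
  A ⊆ ⋃ ℕ α → (es : Vec ℕ l) → (∀ {x} → ¬ A x → ¬ A′ x ⊎ x ∈ differences (map W es)) →
  (∀ {x} → x ∈ differences (map W es) → ¬ A x) →
  let n = suc j * 2 + l in
  ∃[ e ] (X^ n e ≐ ∁ A × (∀ {x s} → x ∈ X^[ n ] e s → ¬ α s x ⊎ x ∈ differences (map W[_, s ] es)))
Presented⇒n-ce {A} {α = α} {j} (g , h , complement , tardy) α-mono A⊆⋃α es rest rest-⊆
  with e , eq ← tuple-surjective (interleave (suc j) g h es)
  = e , subst (λ v → differences (map W v) ≐ ∁ A) (sym eq) (sound , complete) ,
    λ {x} {s} p → map₁ (λ (i , i<k , p , q) → tardy i<k p q)
      (differences-⇒ W[_, s ] (suc j) (subst (λ v → x ∈ differences (map W[_, s ] v)) eq p))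
  where
  sound : differences (map W (interleave (suc j) g h es)) ⊆ ∁ A
  sound p a with differences-⇒ W (suc j) p
  ... | inj₂ q = rest-⊆ q a
  -- At stage `r ⊔ s` the number is both in the difference and in `α`.
  ... | inj₁ (i , i<k , (r , q) , ¬q) with s , x∈α ← A⊆⋃α a =
    tardy i<k (W[]-mono {g i} (m≤m⊔n r s) q) (λ q′ → ¬q (r ⊔ s , q′)) (α-mono (m≤n⊔m r s) x∈α)
  complete : ∁ A ⊆ differences (map W (interleave (suc j) g h es))
  complete x∉A = differences-⇐ W (suc j) (map₁ complement (rest x∉A))

-- The even and the odd case

theorem3p3 : ExcludedMiddle 0ℓ →
    ∀ (n : ℕ) → 2 ≤ n →
    ∀ (A : Pred ℕ 0ℓ) → CE A →
    Q n A →
    ∀ (𝓐 : Enumeration A) → Tardy n 𝓐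
theorem3p3 em _ _ A _ (even {j} q) 𝓐 =
  subst (λ n → Tardy n 𝓐) (trans (+-identityʳ _) (*-comm (suc j) 2)) λ p p-mono pᶜ →
  let c , A⊂C , strategy = QEven⇒Strategy q
      open Argument em (delayed 𝓐 p-mono pᶜ) (delayedᴿ 𝓐 p-mono pᶜ) (delayed-mono 𝓐 p-mono pᶜ)
             (A≐⋃delayed 𝓐 p-mono pᶜ) A⊂C strategy
      e , X≐∁A , avoids = Presented⇒n-ce {A} presented (delayed-mono 𝓐 p-mono pᶜ) (proj₁ (A≐⋃delayed 𝓐 p-mono pᶜ))
                            [] inj₁ (λ ())
  in e , X≐∁A , λ x s x∈X x∈A → [ (λ ¬α → ¬α (stage⊆delayed 𝓐 p-mono pᶜ s {x} x∈A)) , (λ ()) ]′ (avoids x∈X)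
theorem3p3 em _ _ A _ (odd {j} (y , Y⊆∁A , q)) 𝓐 =
  subst (λ n → Tardy n 𝓐) (trans (+-comm _ 1) (cong suc (*-comm (suc j) 2))) λ p p-mono pᶜ →
  let c , A⊂C , strategy = QEven⇒Strategy q
      -- The approximated set is A ∪ Y; only its part `A` has to run ahead of `p`.
      α : ℕ → ℕ → Set
      α s x = delayed 𝓐 p-mono pᶜ s x ⊎ Seen y s x
      α-mono : ∀ {s t x} → s ≤ t → α s x → α t x
      α-mono s≤t = map-⊎ (delayed-mono 𝓐 p-mono pᶜ s≤t) (Seen-mono s≤t)
      A∪Y≐⋃α : A ∪ W y ≐ ⋃ ℕ α
      A∪Y≐⋃α = [ map₂ inj₁ ∘ proj₁ (A≐⋃delayed 𝓐 p-mono pᶜ) , map₂ inj₂ ∘ W⇒Seen ]′ ,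
               λ (s , a) → map-⊎ (λ a → proj₂ (A≐⋃delayed 𝓐 p-mono pᶜ) (s , a)) Seen⇒W a
      open Argument em α (⊎ᴿ (delayedᴿ 𝓐 p-mono pᶜ) (app₃ᴿ Seen Seenᴿ (constᶜ y) (fstᶜ idᶜ) (sndᶜ idᶜ))) α-mono
             A∪Y≐⋃α A⊂C strategy
      rest : ∀ {x} → ¬ A x → ¬ (A ∪ W y) x ⊎ x ∈ W y
      rest {x} x∉A = dec-⊎ x∉A (em {x ∈ W y})
      e , X≐∁A , avoids = Presented⇒n-ce {A} presented α-mono (proj₁ A∪Y≐⋃α ∘ inj₁) (y ∷ []) rest Y⊆∁A
  in e , X≐∁A , λ x s x∈X x∈A →
       [ (λ ¬α → ¬α (inj₁ (stage⊆delayed 𝓐 p-mono pᶜ s {x} x∈A))) ,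
         -- What the last set contributes lies in Y, which no stage of `A` meets.
         (λ x∈Y → Y⊆∁A (s , x∈Y) (proj₂ (exhaustive 𝓐) (p s , x∈A))) ]′
       (avoids x∈X)
  where
  dec-⊎ : ∀ {P Q : Set} → ¬ P → Dec Q → ¬ (P ⊎ Q) ⊎ Q
  dec-⊎ ¬p (yes q) = inj₂ q
  dec-⊎ ¬p (no ¬q) = inj₁ [ ¬p , ¬q ]′
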